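{- For every positive integer $n$, $\delta(n)=\tau(n)$. Moreover, for every positive integer $n$ there exists a subforest $S$ of $\mathcal{T}_\infty$ such that $|S|=n$, $|(S,\overline S)|=\tau(n)$, and all the trees in the forest $S$, except possibly one, are complete binary trees. If $(P,N)$ is a minimal SABP of $n$ in normal form, then the subforest obtained by taking the disjoint union of the C-tree of $(\{\max P\},N)$ and the P-forest of $(P\setminus\{\max P\},\emptyset)$ is such a subforest.
   Context: $\mathcal{T}_\infty$ is the infinite binary tree with all leaves at the same level: its vertices are the pairs $(i,j)$ of integers with $i\ge 1$, $j\ge 0$; the vertex $(i,j)$ has parent $(i+1,\lfloor j/2\rfloor)$, and the edges join each vertex to its parent. The vertex $(i,j)$ is at level (height) $i$; vertices at level $1$ are the leaves, and each vertex $(i,j)$ with $i\ge 2$ has a left child $(i-1,2j)$ and a right child $(i-1,2j+1)$. For a finite vertex set $S$, $\overline S$ is its complement and $(S,\overline S)$ is the set of edges with one end in $S$ and the other in $\overline S$. $\delta(n)=\min\{|(S,\overline S)| : S\subset V(\mathcal{T}_\infty),\ |S|=n\}$. A subforest is identified with its (induced) vertex set. Write $\nu_\ell=\nu(\ell)=2^\ell-1$, and for a finite multiset $P$ of positive integers $\nu(P)=\sum_{i\in P}\nu_i$ (with multiplicity). A signed almost binary partition (SABP) of $n$ is a pair $(P,N)$ of finite multisets of positive integers with $n=\nu(P)-\nu(N)$; its number of parts is $|(P,N)|=|P|+|N|$. $\tau(n)$ is the least number of parts in any SABP of $n$; an SABP attaining it is called minimal. A CABP is an SABP with $|P|=1$;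 an ABP is an SABP with $N=\emptyset$. $\mathrm{Greedy}(m)$ is the multiset of exponents obtained by successively subtracting from $m$ the largest number of the form $2^k-1$, $k\geq 1$, that is at most the current remainder until $0$ is reached ($\mathrm{Greedy}(0)=\emptyset$). An SABP $(P,N)$ of $n$ is in normal form if (A) $P\cap N=\emptyset$; (B) $P=\mathrm{Greedy}(\nu(P))$ and $N=\mathrm{Greedy}(\nu(N))$; (C) $\max(P)\in\{\lfloor\log_2 n\rfloor,1+\lfloor\log_2 n\rfloor\}$. $P\setminus\{\max P\}$ means removing one copy of $\max P$. P-forest of an ABP $(P,\emptyset)$: the forest induced in $\mathcal{T}_\infty$ that is a disjoint union of $|P|$ complete binary trees, having for each $t$ in the multiset $P$ one tree of size $2^t-1$ with its root at level $t$ and all its leaves at the lowest level (level $1$) of $\mathcal{T}_\infty$. C-tree of a CABP $(\{r\},N)$ of a positive integer, where $N=\mathrm{Greedy}(\nu(N))$ (so only the smallest element of $N$ can repeat, and at most twice): start with the subtree of $\mathcal{T}_\infty$ consisting of a vertex $v_r$ at level $r$ and all its descendants. If $N$ has no repeated element let $h=1$; otherwise let $h=t+1$ where $t=\min N$ is the repeated element. Define a path $v_r,v_{r-1},\dots,v_h$ by: for $r\ge j\ge h+1$, $v_{j-1}$ is the right child of $v_j$ if $j-1\notin N$, and the left child of $v_j$ if $j-1\in N$. For $j=r,\dots,h+1$, whenever $v_{j-1}$ is the left child of $v_j$, delete the whole subtree rooted at the right child of $v_j$. Finally, if $h\ne 1$, delete the subtrees rooted at both children of $v_h$. What remains is the C-tree.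 Disjoint union of such trees/forests in $\mathcal{T}_\infty$ means that they are placed on disjoint vertex sets of $\mathcal{T}_\infty$ with no edge of $\mathcal{T}_\infty$ between distinct trees. -}

module Defs where

open import Data.Bool.Base using (if_then_else_)
open import Data.List.Base using (List; []; _∷_; length; map)
open import Data.List.Extrema.Nat using (max; min)
open import Data.List.Membership.DecPropositional using (_∈?_)
open import Data.List.Membership.Propositional using (_∈_)
open import Data.List.Relation.Binary.Disjoint.Propositional using (Disjoint)
open import Data.List.Relation.Binary.Permutation.Propositional using (_↭_)
open import Data.List.Relation.Unary.All using (All)
open import Data.List.Relation.Unary.AllPairs using (AllPairs)
open import Data.List.Relation.Unary.Any using (Any)
open import Data.List.Relation.Unary.Unique.DecPropositional using (unique?)
open import Data.List.Relation.Unary.Unique.Propositional using (Unique)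
open import Data.Nat.Base
  using (ℕ; suc; pred; _+_; _*_; _∸_; _^_; _≤_; _<_; ⌊_/2⌋)
open import Data.Nat.ListAction using (sum)
open import Data.Nat.GeneralisedArithmetic using (iterate)
open import Data.Nat.Logarithm using (⌊log₂_⌋)
open import Data.Nat.Properties using (_≟_)
open import Data.Product.Base using (∃; _×_; _,_)
open import Data.Sum.Base using (_⊎_)
open import Function.Bundles using (_⇔_)
open import Level using (Level; 0ℓ)
open import Relation.Binary.Construct.Closure.ReflexiveTransitive using (Star)
open import Relation.Binary.PropositionalEquality.Core using (_≡_; _≢_)
open import Relation.Nullary.Decidable.Core using (does)
open import Relation.Nullary.Negation.Core using (¬_)
open import Relation.Unary using (Pred; _≐_; _∪_)

private
  variable
    a ℓ : Level
    A : Set a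

IsMin : (ℕ → Set ℓ) → ℕ → Set ℓ
IsMin Q m = Q m × (∀ k → Q k → m ≤ k)

-- P is finite with exactly k elements.
Card : {A : Set a} → Pred A ℓ → ℕ → Set _
Card {A = A} P k =
  ∃ λ (xs : List A) → Unique xs × length xs ≡ k × (∀ x → x ∈ xs ⇔ P x)

------------------------------------------------------------------------
-- The infinite binary tree

-- The pair (k , j) is the vertex (k + 1, j): levels start at 1.
Vertex : Set
Vertex = ℕ × ℕ

level : Vertex → ℕ
level (k , _) = suc k

parent : Vertex → Vertex
parent (k , j) = suc k , ⌊ j /2⌋

-- The values of left and right at the leaves (level 1) are junk; no
-- definition below depends on them.
left right : Vertex → Vertex
left  (k , j) = pred k , 2 * j
right (k , j) = pred k , suc (2 * j)

Adjacent : Vertex → Vertex → Set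
Adjacent u v = u ≡ parent v ⊎ v ≡ parent u

-- w ⊑ v : w is v or a descendant of v.
_⊑_ : Vertex → Vertex → Set
_⊑_ = Star (λ u v → v ≡ parent u)

Subtree : Vertex → Pred Vertex 0ℓ
Subtree v w = w ⊑ v

-- The edge cut (S, complement of S).  Each edge joins a unique vertex v to
-- parent v, and is represented by that v.
Cut : Pred Vertex 0ℓ → Pred Vertex 0ℓ
Cut S v = (S v × ¬ S (parent v)) ⊎ (¬ S v × S (parent v))

IsDelta : ℕ → ℕ → Set₁
IsDelta n = IsMin λ k → ∃ λ (S : Pred Vertex 0ℓ) → Card S n × Card (Cut S) k

------------------------------------------------------------------------
-- Subforests and their trees

Connected : Pred Vertex 0ℓ → Vertex → Vertex → Set
Connected S = Star (λ u v → S u × S v × Adjacent u v)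

-- The tree of the forest S containing u, for u in S.
Component : Pred Vertex 0ℓ → Vertex → Pred Vertex 0ℓ
Component S u = Connected S u

-- The complete binary tree with root r and all its leaves at level l; the
-- leaves need not be at level 1.
IsCompleteBinaryTree : Pred Vertex 0ℓ → Set
IsCompleteBinaryTree C =
  ∃ λ r → ∃ λ l → 1 ≤ l × l ≤ level r × C ≐ (λ w → w ⊑ r × l ≤ level w)

-- The possible exception is the tree containing v.
AllButOneComplete : Pred Vertex 0ℓ → Set
AllButOneComplete S = ∃ λ v → S v ×
  (∀ u → S u → Connected S v u ⊎ IsCompleteBinaryTree (Component S u))

IsGoodForest : ℕ → ℕ → Pred Vertex 0ℓ → Set
IsGoodForest n k S = Card S n × Card (Cut S) k × AllButOneComplete S

-- Vertex-disjoint, with no edge between.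
Separated : Pred Vertex 0ℓ → Pred Vertex 0ℓ → Set
Separated S T = ∀ {u v} → S u → T v → u ≢ v × ¬ Adjacent u v

------------------------------------------------------------------------
-- Signed almost binary partitions
--
-- A finite multiset is a list up to _↭_.

ν : ℕ → ℕ
ν k = 2 ^ k ∸ 1

νSum : List ℕ → ℕ
νSum P = sum (map ν P)

-- n = ν(P) - ν(N), written without truncated subtraction.
IsSABP : ℕ → List ℕ → List ℕ → Set
IsSABP n P N = All (1 ≤_) P × All (1 ≤_) N × n + νSum N ≡ νSum P

parts : List ℕ → List ℕ → ℕ
parts P N = length P + length N

IsTau : ℕ → ℕ → Set
IsTau n = IsMin λ k → ∃ λ P → ∃ λ N → IsSABP n P N × parts P N ≡ k

IsMinimalSABP : ℕ → List ℕ → List ℕ → Set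
IsMinimalSABP n P N = IsSABP n P N × IsTau n (parts P N)

-- GreedyRun m ks : the greedy procedure started at m subtracts
-- ν k for the successive entries k of ks.
data GreedyRun : ℕ → List ℕ → Set where
  stop : GreedyRun 0 []
  step : ∀ {m k ks} → 1 ≤ k → ν k ≤ m → (∀ j → ν j ≤ m → j ≤ k) →
         GreedyRun (m ∸ ν k) ks → GreedyRun m (k ∷ ks)

-- P = Greedy(m) as multisets.
IsGreedy : ℕ → List ℕ → Set
IsGreedy m P = ∃ λ ks → GreedyRun m ks × P ↭ ks

-- The default value 0 is the maximum of the empty multiset only.
maxPart : List ℕ → ℕ
maxPart = max 0

IsNormalForm : ℕ → List ℕ → List ℕ → Set
IsNormalForm n P N =
  Disjoint P N ×
  IsGreedy (νSum P) P × IsGreedy (νSum N) N ×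
  (maxPart P ≡ ⌊log₂ n ⌋ ⊎ maxPart P ≡ 1 + ⌊log₂ n ⌋)

------------------------------------------------------------------------
-- P-forests and C-trees

IsPForest : List ℕ → Pred Vertex 0ℓ → Set
IsPForest P F = ∃ λ (roots : List Vertex) →
  P ↭ map level roots ×
  AllPairs (λ u v → Separated (Subtree u) (Subtree v)) roots ×
  F ≐ (λ w → Any (w ⊑_) roots)

-- The level h at which the path of the C-tree stops.
pathEnd : List ℕ → ℕ
pathEnd []           = 1
pathEnd N@(x ∷ xs) = if does (unique? _≟_ N) then 1 else suc (min x xs)

pathStep : List ℕ → Vertex → Vertex
pathStep N v = if does (_∈?_ _≟_ (pred (level v)) N) then left v else right v

-- path N v j is the path vertex v_j at level j, for j ≤ level v, where v = v_r.
path : List ℕ → Vertex → ℕ → Vertex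
path N v j = iterate (pathStep N) v (level v ∸ j)

-- In side, j is the level of the lower end of a path edge: at v_{j+1} the path
-- goes left to v_j, and the right child of v_{j+1} is cut off.
data Deleted (N : List ℕ) (v w : Vertex) : Set where
  side : ∀ j → pathEnd N ≤ j → j < level v →
         path N v j ≡ left (path N v (suc j)) →
         w ⊑ right (path N v (suc j)) → Deleted N v w
  end  : pathEnd N ≢ 1 →
         w ⊑ left (path N v (pathEnd N)) ⊎ w ⊑ right (path N v (pathEnd N)) →
         Deleted N v w

IsCTree : ℕ → List ℕ → Pred Vertex 0ℓ → Set
IsCTree r N C = ∃ λ v → level v ≡ r × C ≐ (λ w → w ⊑ v × ¬ Deleted N v w)

-- S is some disjoint union, placed in the tree, of the C-tree of
-- ({max P}, N) and the P-forest of (Q, ∅), where Q = P ∖ {max P}.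
IsSABPForest : List ℕ → List ℕ → Pred Vertex 0ℓ → Set₁
IsSABPForest P N S =
  ∃ λ (Q : List ℕ) → ∃ λ (C : Pred Vertex 0ℓ) → ∃ λ (F : Pred Vertex 0ℓ) →
  P ↭ maxPart P ∷ Q × IsCTree (maxPart P) N C × IsPForest Q F ×
  Separated C F × S ≐ (C ∪ F)

{-# OPTIONS --safe #-}
-- Inserting a part ν k into a greedy list costs at most one part, so greedy
-- lists have the fewest parts and τ(n) is the minimum over m of
-- |Greedy(n + m)| + |Greedy(m)|.  For m ≥ n the top parts of the two lists are
-- equal or consecutive, and cancelling them (using ν (1 + s) - ν s = ν s + ν 1)
-- gives a smaller m that is no worse; hence the minimum is attained at some m < n.
--
-- Weight a vertex of level l by ν l, the size of its subtree.  For finite S, |S|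
-- is the total weight of the v in S with parent outside S minus that of the v
-- outside S with parent in S.  So the levels of the cut edges of S form an SABP
-- of |S|, which gives δ ≥ τ.  Conversely the cut edges of the forest built from
-- (P , N) lie above the roots and above the subtrees deleted from the C-tree;
-- their levels are P and N, so by the same identity its size is n.
module Submission where

open import Defs
open import Data.Bool.Base using (true; false; if_then_else_)
open import Data.List.Base
  using (List; []; _∷_; _++_; length; map; filter; concatMap; deduplicate; upTo)
open import Data.List.Extrema.Nat
  using (min; argmin; f[argmin]≤f[xs]; min≤v⁺; v≤min⁺; xs≤max; max≈v⁺; argmax-sel)
open import Data.List.Membership.DecPropositional using () renaming (_∈?_ to mem?)
open import Data.List.Membership.Propositional using (_∈_; _∉_; find; lose)
open import Data.List.Membership.Propositional.Properties
open import Data.List.Membership.Propositional.Properties.WithK using (unique∧set⇒bag)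
open import Data.List.Properties using (map-++; length-map; length-++; map-∘; map-id-local)
open import Data.List.Relation.Binary.BagAndSetEquality using (∼bag⇒↭)
open import Data.List.Relation.Binary.Permutation.Propositional
  using (_↭_; ↭-sym; ↭-trans; ↭-refl; ↭-reflexive; prep; swap; ↭⇒↭ₛ)
import Data.List.Relation.Binary.Permutation.Propositional.Properties as ↭
import Data.List.Relation.Binary.Permutation.Setoid.Properties as Setoid↭
import Data.List.Relation.Unary.All as All
open import Data.List.Relation.Unary.All using (All; []; _∷_)
import Data.List.Relation.Unary.All.Properties as All
import Data.List.Relation.Unary.AllPairs as AllPairs
open import Data.List.Relation.Unary.AllPairs using (AllPairs; []; _∷_)
import Data.List.Relation.Unary.Any as Any
open import Data.List.Relation.Unary.Any using (Any; here; there)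
import Data.List.Relation.Unary.Any.Properties as Any
open import Data.List.Relation.Unary.Unique.DecPropositional using (unique?)
import Data.List.Relation.Unary.Unique.DecPropositional.Properties as UniqueDec
open import Data.List.Relation.Unary.Unique.Propositional using (Unique)
import Data.List.Relation.Unary.Unique.Propositional.Properties as Unique
open import Data.Nat.Base
open import Data.Nat.GeneralisedArithmetic using (iterate)
open import Data.Nat.Induction using (Acc; acc; <-wellFounded)
open import Data.Nat.ListAction using (sum)
open import Data.Nat.ListAction.Properties using (sum-++; sum-↭)
open import Data.Nat.Properties
open import Data.Nat.Tactic.RingSolver using (solve-∀)
open import Data.Product.Base using (∃; _×_; _,_; proj₁; proj₂)
open import Data.Product.Properties using (≡-dec)
open import Data.Sum.Base using (_⊎_; inj₁; inj₂; [_,_]′)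
open import Function.Base using (_∘_; id)
open import Function.Bundles using (_⇔_; mk⇔; Equivalence)
open import Level using (0ℓ)
import Relation.Binary.Construct.Closure.ReflexiveTransitive as Star
open import Relation.Binary.Construct.Closure.ReflexiveTransitive using (ε; _◅_; _◅◅_)
open import Relation.Binary.PropositionalEquality
open import Relation.Nullary
  using (¬_; Dec; yes; no; contradiction; ¬?; _×-dec_; _⊎-dec_; does)
open import Relation.Nullary.Decidable using (map′; dec-true; dec-false)
open import Relation.Unary using (Pred; Decidable; _≐_; _∪_)

open Equivalence using (to; from)

-- Greedy partitions

suc-ν : ∀ k → suc (ν k) ≡ 2 ^ k
suc-ν k = m+[n∸m]≡n (m^n>0 2 k)

ν-suc : ∀ k → ν (suc k) ≡ suc (ν k + ν k)
ν-suc k = suc-injective (begin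
  suc (ν (suc k))              ≡⟨ suc-ν (suc k) ⟩
  2 * 2 ^ k                    ≡⟨ cong (2 *_) (suc-ν k) ⟨
  2 * suc (ν k)                ≡⟨ lemma (ν k) ⟩
  suc (suc (ν k + ν k))        ∎)
  where
  open ≡-Reasoning
  lemma : ∀ x → 2 * suc x ≡ suc (suc (x + x))
  lemma = solve-∀

ν-mono-≤ : ∀ {j k} → j ≤ k → ν j ≤ ν k
ν-mono-≤ j≤k = ∸-monoˡ-≤ 1 (^-monoʳ-≤ 2 j≤k)

ν-double-< : ∀ {j k} → j < k → ν j + ν j < ν k
ν-double-< {j} {k} j<k = begin
  suc (ν j + ν j)  ≡⟨ ν-suc j ⟨
  ν (suc j)        ≤⟨ ν-mono-≤ j<k ⟩
  ν k              ∎
  where open ≤-Reasoning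

ν-mono-< : ∀ {j k} → j < k → ν j < ν k
ν-mono-< {j} j<k = ≤-<-trans (m≤m+n (ν j) (ν j)) (ν-double-< j<k)

ν-cancel-≤ : ∀ {j k} → ν j ≤ ν k → j ≤ k
ν-cancel-≤ νj≤νk = ≮⇒≥ λ k<j → <⇒≱ (ν-mono-< k<j) νj≤νk

ν-positive : ∀ {k} → 1 ≤ k → 1 ≤ ν k
ν-positive 1≤k = ν-mono-< 1≤k

-- Since ν (1 + k) = 2 ν k + 1, the largest ν k at most m is the one with
-- m - ν k between 0 and ν k.
data GreedyList : List ℕ → Set where
  []  : GreedyList []
  cons : ∀ {k ks} → 1 ≤ k → νSum ks ≤ ν k → GreedyList ks → GreedyList (k ∷ ks)

run-sum : ∀ {m ks} → GreedyRun m ks → νSum ks ≡ m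
run-sum stop = refl
run-sum (step {k = k} 1≤k νk≤m _ run) =
  trans (cong (ν k +_) (run-sum run)) (m+[n∸m]≡n νk≤m)

run⇒greedyList : ∀ {m ks} → GreedyRun m ks → GreedyList ks
run⇒greedyList stop = []
run⇒greedyList {m} (step {k = k} {ks} 1≤k νk≤m largest run) =
  cons 1≤k (subst (_≤ ν k) (sym (run-sum run)) rest≤) (run⇒greedyList run)
  where
  m<ν[1+k] : m < ν (suc k)
  m<ν[1+k] = ≰⇒> λ ν[1+k]≤m → 1+n≰n (largest (suc k) ν[1+k]≤m)

  rest≤ : m ∸ ν k ≤ ν k
  rest≤ = m≤n+o⇒m∸n≤o m (ν k) (s≤s⁻¹ (subst (m <_) (ν-suc k) m<ν[1+k]))

greedyList-1≤ : ∀ {ks} → GreedyList ks → All (1 ≤_) ks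
greedyList-1≤ []              = []
greedyList-1≤ (cons 1≤k _ g) = 1≤k ∷ greedyList-1≤ g

tail-≤ : ∀ {k ks} → GreedyList (k ∷ ks) → νSum ks ≤ ν k
tail-≤ (cons _ ks≤k _) = ks≤k

head-ub : ∀ {k ks} → GreedyList (k ∷ ks) → νSum (k ∷ ks) ≤ ν k + ν k
head-ub g = +-monoʳ-≤ _ (tail-≤ g)

-- For j < k, 2 ν j < ν k, so the intervals from ν r to 2 ν r are disjoint, and the sum of a greedy
-- list lies in the interval of its head.
head-unique : ∀ {k ks r} → GreedyList (k ∷ ks) →
              ν r ≤ νSum (k ∷ ks) → νSum (k ∷ ks) ≤ ν r + ν r → k ≡ r
head-unique {k} {ks} {r} g r≤ ≤r = ≤-antisym k≤r r≤k
  where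
  k≤r : k ≤ r
  k≤r = ≮⇒≥ λ r<k → <⇒≱ (ν-double-< r<k) (≤-trans (m≤m+n (ν k) _) ≤r)

  r≤k : r ≤ k
  r≤k = ≮⇒≥ λ k<r → <⇒≱ (ν-double-< k<r) (≤-trans r≤ (head-ub g))

greedyList-unique : ∀ {ks ls} → GreedyList ks → GreedyList ls →
                    νSum ks ≡ νSum ls → ks ≡ ls
greedyList-unique [] [] _ = refl
greedyList-unique [] (cons 1≤l _ _) eq =
  contradiction (sym eq) (m<n⇒n≢0 (≤-trans (ν-positive 1≤l) (m≤m+n _ _)))
greedyList-unique (cons 1≤k _ _) [] eq =
  contradiction eq (m<n⇒n≢0 (≤-trans (ν-positive 1≤k) (m≤m+n _ _)))
greedyList-unique {k ∷ ks} {l ∷ ls} g@(cons _ _ g′) h@(cons _ _ h′) eq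
  with refl ← head-unique {r = l} g (subst (ν l ≤_) (sym eq) (m≤m+n (ν l) _))
                                    (subst (_≤ ν l + ν l) (sym eq) (head-ub h))
  = cong (k ∷_) (greedyList-unique g′ h′ (+-cancelˡ-≡ (ν k) _ _ eq))

-- Insertion of a part into a greedy list

record GreedyWithin (m b : ℕ) : Set where
  constructor within
  field
    list     : List ℕ
    isGreedy : GreedyList list
    sum≡     : νSum list ≡ m
    length≤  : length list ≤ b

-- The length is bounded, not fixed, because carries can shorten the list. The part 0, with ν 0 = 0,
-- is allowed, since `double-head` replaces a part `suc i` by two copies of i.
Insert : List ℕ → Set
Insert ks = GreedyList ks → ∀ k → GreedyWithin (νSum ks + ν k) (suc (length ks))

-- 2 ν r + ν (1 + i) = ν (1 + r) + 2 ν i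
double-head : ∀ {r ls} → (∀ us → νSum us < νSum ls → Insert us) →
              GreedyList (r ∷ ls) → 1 ≤ νSum ls →
              GreedyWithin (ν r + νSum (r ∷ ls)) (suc (length (r ∷ ls)))
double-head {ls = []} _ _ ()
double-head {ls = zero ∷ js} _ (cons _ _ (cons () _ _)) _
double-head {r} {suc i ∷ js} ins (cons _ ls≤r (cons _ _ g)) _ =
  within (suc r ∷ G.list step₂) (cons (s≤s z≤n) vs≤ (G.isGreedy step₂)) vs-sum
    (s≤s (≤-trans (G.length≤ step₂) (s≤s (G.length≤ step₁))))
  where
  module G = GreedyWithin

  double : ν (suc i) + νSum js ≡ suc (νSum js + ν i + ν i)
  double = trans (cong (_+ νSum js) (ν-suc i))
    (cong suc (trans (+-comm (ν i + ν i) _) (sym (+-assoc (νSum js) (ν i) (ν i)))))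

  js+i< : νSum js + ν i < νSum (suc i ∷ js)
  js+i< = subst (νSum js + ν i <_) (sym double) (s≤s (m≤m+n _ (ν i)))

  -- Both insertions are into lists of sum at most `νSum js + ν i`, below `νSum (suc i ∷ js)`, so
  -- `ins` applies. The parts r and `suc i` give way to `suc r` and two insertions, at most one part
  -- more in all.
  step₁ : GreedyWithin (νSum js + ν i) (suc (length js))
  step₁ = ins js (≤-<-trans (m≤m+n _ (ν i)) js+i<) g i

  step₂ : GreedyWithin (νSum (G.list step₁) + ν i) (suc (length (G.list step₁)))
  step₂ = ins (G.list step₁) (subst (_< _) (sym (G.sum≡ step₁)) js+i<) (G.isGreedy step₁) i

  vs-sum′ : νSum (G.list step₂) ≡ νSum js + ν i + ν i
  vs-sum′ = trans (G.sum≡ step₂) (cong (_+ ν i) (G.sum≡ step₁))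

  vs≤ : νSum (G.list step₂) ≤ ν (suc r)
  vs≤ = begin
    νSum (G.list step₂)        ≡⟨ vs-sum′ ⟩
    νSum js + ν i + ν i        ≤⟨ n≤1+n _ ⟩
    suc (νSum js + ν i + ν i)  ≡⟨ double ⟨
    ν (suc i) + νSum js        ≤⟨ ls≤r ⟩
    ν r                        ≤⟨ ν-mono-≤ (n≤1+n r) ⟩
    ν (suc r)                  ∎
    where open ≤-Reasoning

  vs-sum : νSum (suc r ∷ G.list step₂) ≡ ν r + νSum (r ∷ suc i ∷ js)
  vs-sum = begin
    ν (suc r) + νSum (G.list step₂)          ≡⟨ cong₂ _+_ (ν-suc r) vs-sum′ ⟩
    suc (ν r + ν r) + (νSum js + ν i + ν i)  ≡⟨ +-suc _ _ ⟨
    ν r + ν r + suc (νSum js + ν i + ν i)    ≡⟨ cong (ν r + ν r +_) double ⟨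
    ν r + ν r + (ν (suc i) + νSum js)        ≡⟨ +-assoc (ν r) (ν r) _ ⟩
    ν r + (ν r + (ν (suc i) + νSum js))      ∎
    where open ≡-Reasoning

-- A part above the head goes in front. Otherwise it is inserted into the tail; if the new tail
-- exceeds ν r, it is still at most 2 ν r and so has head r, and `double-head` merges the two copies
-- of r.
insert : ∀ ks → Acc _<_ (νSum ks) → Insert ks
insert ks _ g zero = within ks g (sym (+-identityʳ _)) (n≤1+n _)
insert [] _ [] k@(suc _) = within (k ∷ []) (cons (s≤s z≤n) z≤n []) (+-identityʳ (ν k)) ≤-refl
insert (r ∷ ks) (acc rec) g@(cons 1≤r ks≤r g′) k@(suc _) with k ≤? r
... | no k≰r = within (k ∷ r ∷ ks) (cons (s≤s z≤n) r∷ks≤k g) (+-comm (ν k) _) ≤-refl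
  where
  r∷ks≤k : νSum (r ∷ ks) ≤ ν k
  r∷ks≤k = ≤-trans (head-ub g) (<⇒≤ (ν-double-< (≰⇒> k≰r)))
... | yes k≤r with insert ks (rec (m<n+m (νSum ks) (ν-positive 1≤r))) g′ k
                | νSum ks + ν k ≤? ν r
...   | within ls h ls≡ len | yes fits =
        within (r ∷ ls) (cons 1≤r (subst (_≤ ν r) (sym ls≡) fits) h)
          (trans (cong (ν r +_) ls≡) (sym (+-assoc (ν r) (νSum ks) (ν k)))) (s≤s len)
...   | within [] _ ls≡ _ | no overflow =
        contradiction (subst (_≤ ν r) ls≡ z≤n) overflow
...   | within (r′ ∷ ls) h ls≡ len | no overflow
        with refl ← head-unique {r = r} h (subst (ν r ≤_) (sym ls≡) (<⇒≤ (≰⇒> overflow)))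
                      (subst (_≤ ν r + ν r) (sym ls≡) (+-mono-≤ ks≤r (ν-mono-≤ k≤r)))
        with within vs v vs≡ len′ ←
          double-head
            (λ us us<ls → insert us (rec (<-≤-trans us<ls (≤-trans (tail-≤ h) (m≤m+n (ν r) _)))))
            h
            -- The overflow is strict, so something remains after the second r.
            (+-cancelˡ-< (ν r) 0 (νSum ls)
              (subst₂ _<_ (sym (+-identityʳ (ν r))) (sym ls≡) (≰⇒> overflow)))
        = within vs v (trans vs≡ (trans (cong (ν r +_) ls≡) (sym (+-assoc (ν r) (νSum ks) (ν k)))))
            (≤-trans len′ (s≤s len))

insertPart : ∀ {m b} → GreedyWithin m b → ∀ k → GreedyWithin (m + ν k) (suc b)
insertPart (within ks g refl len) k with insert ks (<-wellFounded _) g k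
... | within ls h ls≡ len′ = within ls h ls≡ (≤-trans len′ (s≤s len))

greedy-optimal : ∀ P → GreedyWithin (νSum P) (length P)
greedy-optimal []      = within [] [] refl z≤n
greedy-optimal (k ∷ P) =
  subst (λ m → GreedyWithin m (suc (length P))) (+-comm (νSum P) (ν k))
        (insertPart (greedy-optimal P) k)

-- Inserting ν 1 = 1 repeatedly, m times, constructs a greedy list of every sum m.
greedyWithin : ∀ m → GreedyWithin m m
greedyWithin zero    = within [] [] refl z≤n
greedyWithin (suc m) =
  subst (λ x → GreedyWithin x (suc m)) (+-comm m 1) (insertPart (greedyWithin m) 1)

greedy : ℕ → List ℕ
greedy m = GreedyWithin.list (greedyWithin m)

greedy-isGreedy : ∀ m → GreedyList (greedy m)
greedy-isGreedy m = GreedyWithin.isGreedy (greedyWithin m)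

greedy-sum : ∀ m → νSum (greedy m) ≡ m
greedy-sum m = GreedyWithin.sum≡ (greedyWithin m)

-- By uniqueness, any greedy list of sum m is `greedy m` itself.
length-greedy≤ : ∀ {m b} → GreedyWithin m b → length (greedy m) ≤ b
length-greedy≤ {m} (within ks g ks≡m len)
  with refl ← greedyList-unique g (greedy-isGreedy m) (trans ks≡m (sym (greedy-sum m))) = len

-- The fewest parts of an SABP (P , N) of n with ν(N) = m.
cost : ℕ → ℕ → ℕ
cost n m = length (greedy (n + m)) + length (greedy m)

cost-≤ : ∀ {n m a b} → GreedyWithin (n + m) a → GreedyWithin m b → cost n m ≤ a + b
cost-≤ G H = +-mono-≤ (length-greedy≤ G) (length-greedy≤ H)

-- A common head cancels without changing the difference n, and tails of greedy lists are greedy.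
cost-cancel : ∀ n {k ks ls} → GreedyList (k ∷ ks) → GreedyList (k ∷ ls) →
              νSum (k ∷ ks) ≡ n + νSum (k ∷ ls) → cost n (νSum ls) ≤ length ks + length ls
cost-cancel n {k} {ks} {ls} (cons _ _ g) (cons _ _ h) eq =
  cost-≤ (within ks g ks≡ ≤-refl) (within ls h refl ≤-refl)
  where
  rearrange : ∀ a b c → a + (b + c) ≡ b + (a + c)
  rearrange = solve-∀
  ks≡ : νSum ks ≡ n + νSum ls
  ks≡ = +-cancelˡ-≡ (ν k) _ _ (trans eq (rearrange n (ν k) (νSum ls)))

module _ {n : ℕ} (1≤n : 1 ≤ n) where

  -- Let r and s be the heads for n + m and m. If r < s, then n + m ≤ 2 ν r < ν s ≤ m, which is
  -- absurd. If r ≥ s + 2, then n + m ≤ 2 m ≤ 4 ν s < ν r, again absurd. So r is s or s + 1, and the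
  -- tail of `greedy m` supplies the smaller m. In the second case s and 1 are inserted into the
  -- other tail: two heads are lost and at most two parts gained.
  cost-descends : ∀ {m} → n ≤ m → ∃ λ m′ → m′ < m × cost n m′ ≤ cost n m
  cost-descends {m} n≤m
    with greedy (n + m) | greedy-isGreedy (n + m) | greedy-sum (n + m)
       | greedy m | greedy-isGreedy m | greedy-sum m
  ... | [] | _ | n+m≡ | _ | _ | _ =
        contradiction (sym n+m≡) (m<n⇒n≢0 (≤-trans 1≤n (m≤m+n n m)))
  ... | _ | _ | _ | [] | _ | m≡ =
        contradiction (sym m≡) (m<n⇒n≢0 (≤-trans 1≤n n≤m))
  ... | r ∷ ks | g@(cons _ _ g′) | n+m≡ | s ∷ ls | h@(cons 1≤s _ h′) | refl
      with r ≟ s | r ≟ suc s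
  ...   | yes refl | _ = νSum ls , m<n+m (νSum ls) (ν-positive 1≤s) ,
          ≤-trans (cost-cancel n g h n+m≡) (+-mono-≤ (n≤1+n _) (n≤1+n _))
  -- ν (1 + s) - ν s = ν s + ν 1
  ...   | no _ | yes refl = νSum ls , m<n+m (νSum ls) (ν-positive 1≤s) ,
          ≤-trans
            (cost-≤ (subst (λ x → GreedyWithin x (2 + length ks)) eq
                      (insertPart (insertPart (within ks g′ refl ≤-refl) s) 1))
                    (within ls h′ refl ≤-refl))
            (≤-reflexive (sym (+-suc (suc (length ks)) (length ls))))
    where
    eq : νSum ks + ν s + ν 1 ≡ n + νSum ls
    eq = +-cancelˡ-≡ (ν s) _ _ (begin
      ν s + (νSum ks + ν s + 1)       ≡⟨ shuffle (ν s) (νSum ks) ⟩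
      suc (ν s + ν s) + νSum ks       ≡⟨ cong (_+ νSum ks) (ν-suc s) ⟨
      ν (suc s) + νSum ks             ≡⟨ n+m≡ ⟩
      n + (ν s + νSum ls)             ≡⟨ rearrange n (ν s) (νSum ls) ⟩
      ν s + (n + νSum ls)             ∎)
      where
      open ≡-Reasoning
      shuffle : ∀ x y → x + (y + x + 1) ≡ suc (x + x) + y
      shuffle = solve-∀
      rearrange : ∀ a b c → a + (b + c) ≡ b + (a + c)
      rearrange = solve-∀
  ...   | no r≢s | no r≢1+s with ≤-total r s
  ...     | inj₁ r≤s = contradiction n+m≡ (<⇒≢ (begin-strict
            ν r + νSum ks        ≤⟨ head-ub g ⟩
            ν r + ν r            <⟨ ν-double-< (≤∧≢⇒< r≤s r≢s) ⟩
            ν s                  ≤⟨ m≤m+n (ν s) (νSum ls) ⟩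
            ν s + νSum ls        ≤⟨ m≤n+m _ n ⟩
            n + (ν s + νSum ls)  ∎))
    where open ≤-Reasoning
  ...     | inj₂ s≤r = contradiction (sym n+m≡) (<⇒≢ (begin-strict
            n + (ν s + νSum ls)  ≤⟨ +-mono-≤ (≤-trans n≤m (head-ub h)) (head-ub h) ⟩
            2s + 2s              ≤⟨ +-mono-≤ (n≤1+n 2s) (n≤1+n 2s) ⟩
            suc 2s + suc 2s      ≡⟨ cong₂ _+_ (ν-suc s) (ν-suc s) ⟨
            ν (suc s) + ν (suc s) <⟨ ν-double-< (≤∧≢⇒< (≤∧≢⇒< s≤r (≢-sym r≢s)) (≢-sym r≢1+s)) ⟩
            ν r                  ≤⟨ m≤m+n (ν r) (νSum ks) ⟩
            ν r + νSum ks        ∎))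
    where
    open ≤-Reasoning
    2s = ν s + ν s

  -- Repeated descent from any m ends below n at no greater cost, so a search among m < n suffices.
  -- The default 0 of `argmin` is itself an admissible m.
  optimum : ∃ λ m → ∀ m′ → cost n m ≤ cost n m′
  optimum = best , λ m′ → below m′ (<-wellFounded m′)
    where
    best = argmin (cost n) 0 (upTo n)
    below : ∀ m → Acc _<_ m → cost n best ≤ cost n m
    below m (acc rec) with m <? n
    ... | yes m<n = All.lookup (f[argmin]≤f[xs] 0 (upTo n)) (∈-upTo⁺ m<n)
    ... | no  m≮n with cost-descends (≮⇒≥ m≮n)
    ...   | m′ , m′<m , cheaper = ≤-trans (below m′ (rec m′<m)) cheaper

-- The cut of a finite vertex set

unique-↭ : ∀ {A : Set} {xs ys : List A} → Unique xs → Unique ys →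
           (∀ {x} → x ∈ xs ⇔ x ∈ ys) → xs ↭ ys
unique-↭ xs! ys! same = ∼bag⇒↭ (unique∧set⇒bag xs! ys! same)

νSum-++ : ∀ P Q → νSum (P ++ Q) ≡ νSum P + νSum Q
νSum-++ P Q = trans (cong sum (map-++ ν P Q)) (sum-++ (map ν P) (map ν Q))

νSum-↭ : ∀ {P Q} → P ↭ Q → νSum P ≡ νSum Q
νSum-↭ P↭Q = sum-↭ (↭.map⁺ ν P↭Q)

_≟ⱽ_ : (u v : Vertex) → Dec (u ≡ v)
_≟ⱽ_ = ≡-dec _≟_ _≟_

⌊2*n/2⌋ : ∀ n → ⌊ 2 * n /2⌋ ≡ n
⌊2*n/2⌋ n = trans (cong (λ x → ⌊ n + x /2⌋) (+-identityʳ n)) (sym (n≡⌊n+n/2⌋ n))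

⌊1+2*n/2⌋ : ∀ n → ⌊ suc (2 * n) /2⌋ ≡ n
⌊1+2*n/2⌋ n = trans (cong (λ x → ⌊ suc (n + x) /2⌋) (+-identityʳ n)) (sym (n≡⌈n+n/2⌉ n))

even∨odd : ∀ n → n ≡ 2 * ⌊ n /2⌋ ⊎ n ≡ suc (2 * ⌊ n /2⌋)
even∨odd zero          = inj₁ refl
even∨odd (suc zero)    = inj₂ refl
even∨odd (suc (suc n)) with even∨odd n
... | inj₁ eq = inj₁ (trans (cong (2 +_) eq) (sym (*-suc 2 ⌊ n /2⌋)))
... | inj₂ eq = inj₂ (trans (cong (2 +_) eq) (cong suc (sym (*-suc 2 ⌊ n /2⌋))))

parent-left : ∀ {v} → 1 < level v → parent (left v) ≡ v
parent-left {suc k , j} _ = cong (suc k ,_) (⌊2*n/2⌋ j)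
parent-left {zero , j} (s≤s ())

parent-right : ∀ {v} → 1 < level v → parent (right v) ≡ v
parent-right {suc k , j} _ = cong (suc k ,_) (⌊1+2*n/2⌋ j)
parent-right {zero , j} (s≤s ())

left≢right : ∀ u v → left u ≢ right v
left≢right (_ , i) (_ , j) eq = even≢odd i j (cong proj₂ eq)

-- The first coordinate is the level minus 1, so (0, j) is a leaf; `left` and `right` would give
-- values there that are not children.
children : Vertex → List Vertex
children (zero  , j) = []
children (suc k , j) = (k , 2 * j) ∷ (k , suc (2 * j)) ∷ []

∈-children⁻ : ∀ {w u} → w ∈ children u → parent w ≡ u
∈-children⁻ {u = suc k , j} (here refl)         = parent-left {suc k , j} (s≤s (s≤s z≤n))
∈-children⁻ {u = suc k , j} (there (here refl)) = parent-right {suc k , j} (s≤s (s≤s z≤n))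

∈-children⁺ : ∀ w → w ∈ children (parent w)
∈-children⁺ (k , j) with even∨odd j
... | inj₁ eq = here (cong (k ,_) eq)
... | inj₂ eq = there (here (cong (k ,_) eq))

children-! : ∀ u → Unique (children u)
children-! (zero  , j) = []
children-! (suc k , j) = (left≢right (suc k , j) (suc k , j) ∷ []) ∷ [] ∷ []

allChildren : List Vertex → List Vertex
allChildren = concatMap children

∈-allChildren : ∀ {w} xs → w ∈ allChildren xs ⇔ parent w ∈ xs
∈-allChildren {w} xs = mk⇔ (⇒ xs) (⇐ xs)
  where
  ⇒ : ∀ xs → w ∈ allChildren xs → parent w ∈ xs
  ⇒ (x ∷ xs) w∈ with ∈-++⁻ (children x) w∈
  ... | inj₁ w∈x  = here (∈-children⁻ w∈x)
  ... | inj₂ w∈xs = there (⇒ xs w∈xs)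
  ⇐ : ∀ xs → parent w ∈ xs → w ∈ allChildren xs
  ⇐ (x ∷ xs) (here refl) = ∈-++⁺ˡ (∈-children⁺ w)
  ⇐ (x ∷ xs) (there p∈)  = ∈-++⁺ʳ (children x) (⇐ xs p∈)

allChildren-! : ∀ {xs} → Unique xs → Unique (allChildren xs)
allChildren-! []                = []
allChildren-! {x ∷ xs} (x∉xs ∷ xs!) =
  Unique.++⁺ (children-! x) (allChildren-! xs!) λ (w∈x , w∈xs) →
    All.All¬⇒¬Any x∉xs (subst (_∈ xs) (∈-children⁻ w∈x) (to (∈-allChildren xs) w∈xs))

levelSum : List Vertex → ℕ
levelSum = νSum ∘ map level

levelSum-++ : ∀ xs ys → levelSum (xs ++ ys) ≡ levelSum xs + levelSum ys
levelSum-++ xs ys = trans (cong νSum (map-++ level xs ys)) (νSum-++ (map level xs) (map level ys))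

levelSum-↭ : ∀ {xs ys} → xs ↭ ys → levelSum xs ≡ levelSum ys
levelSum-↭ xs↭ys = νSum-↭ (↭.map⁺ level xs↭ys)

levelSum-children : ∀ u → ν (level u) ≡ suc (levelSum (children u))
levelSum-children (zero  , j) = refl
levelSum-children (suc k , j) =
  trans (ν-suc (suc k)) (cong suc (cong (ν (suc k) +_) (sym (+-identityʳ (ν (suc k))))))

levelSum-allChildren : ∀ xs → levelSum xs ≡ length xs + levelSum (allChildren xs)
levelSum-allChildren []       = refl
levelSum-allChildren (x ∷ xs) = begin
  ν (level x) + levelSum xs
    ≡⟨ cong₂ _+_ (levelSum-children x) (levelSum-allChildren xs) ⟩
  suc (levelSum (children x)) + (length xs + levelSum (allChildren xs))
    ≡⟨ rearrange (levelSum (children x)) (length xs) _ ⟩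
  suc (length xs) + (levelSum (children x) + levelSum (allChildren xs))
    ≡⟨ cong (suc (length xs) +_) (levelSum-++ (children x) (allChildren xs)) ⟨
  suc (length xs) + levelSum (allChildren (x ∷ xs)) ∎
  where
  open ≡-Reasoning
  rearrange : ∀ a b c → suc a + (b + c) ≡ suc b + (a + c)
  rearrange = solve-∀

-- The weighted cut identity

Enumerates : {A : Set} → List A → Pred A 0ℓ → Set
Enumerates xs P = Unique xs × (∀ x → x ∈ xs ⇔ P x)

-- The two halves of the cut: the levels of the first will form P, those of the second N.
Up Down : Pred Vertex 0ℓ → Pred Vertex 0ℓ
Up   S v = S v × ¬ S (parent v)
Down S v = ¬ S v × S (parent v)

-- ν (level v) - 2 ν (level v - 1) = 1, so summing the weights ν ∘ level over S
-- and subtracting those over the children of S counts S; the vertices belonging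
-- to S together with their parents cancel.
cut-identity : ∀ {S : Pred Vertex 0ℓ} {xs us ds} →
  Enumerates xs S → Enumerates us (Up S) → Enumerates ds (Down S) →
  length xs + levelSum ds ≡ levelSum us
cut-identity {S} {xs} {us} {ds} (xs! , xs⇔S) (us! , us⇔) (ds! , ds⇔) =
  sym (+-cancelʳ-≡ (levelSum both) _ _ (begin
    levelSum us + levelSum both                 ≡⟨ levelSum-++ us both ⟨
    levelSum (us ++ both)                       ≡⟨ levelSum-↭ xs↭ ⟨
    levelSum xs                                 ≡⟨ levelSum-allChildren xs ⟩
    length xs + levelSum (allChildren xs)       ≡⟨ cong (length xs +_) (levelSum-↭ children↭) ⟩
    length xs + levelSum (ds ++ both)           ≡⟨ cong (length xs +_) (levelSum-++ ds both) ⟩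
    length xs + (levelSum ds + levelSum both)   ≡⟨ +-assoc (length xs) _ _ ⟨
    length xs + levelSum ds + levelSum both     ∎))
  where
  open ≡-Reasoning
  open import Data.List.Membership.DecPropositional _≟ⱽ_ using (_∈?_)

  parent∈? : Decidable (λ v → parent v ∈ xs)
  parent∈? v = parent v ∈? xs

  -- Common to both decompositions: a vertex of S outside `us` has its parent in S, and a child of a
  -- vertex of S, if outside `ds`, is itself in S.
  both : List Vertex
  both = filter parent∈? xs

  xs↭ : xs ↭ us ++ both
  xs↭ = unique-↭ xs!
    (Unique.++⁺ us! (Unique.filter⁺ parent∈? xs!) λ {v} (v∈us , v∈both) →
      proj₂ (to (us⇔ v) v∈us) (to (xs⇔S _) (proj₂ (∈-filter⁻ parent∈? {xs = xs} v∈both))))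
    (λ {v} → mk⇔ (⇒ v) (⇐ v))
    where
    ⇒ : ∀ v → v ∈ xs → v ∈ us ++ both
    ⇒ v v∈xs with parent∈? v
    ... | yes p∈xs = ∈-++⁺ʳ us (∈-filter⁺ parent∈? v∈xs p∈xs)
    ... | no  p∉xs = ∈-++⁺ˡ (from (us⇔ v) (to (xs⇔S v) v∈xs , p∉xs ∘ from (xs⇔S _)))
    ⇐ : ∀ v → v ∈ us ++ both → v ∈ xs
    ⇐ v v∈ with ∈-++⁻ us v∈
    ... | inj₁ v∈us   = from (xs⇔S v) (proj₁ (to (us⇔ v) v∈us))
    ... | inj₂ v∈both = proj₁ (∈-filter⁻ parent∈? v∈both)

  children↭ : allChildren xs ↭ ds ++ both
  children↭ = unique-↭ (allChildren-! xs!)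
    (Unique.++⁺ ds! (Unique.filter⁺ parent∈? xs!) λ {v} (v∈ds , v∈both) →
      proj₁ (to (ds⇔ v) v∈ds) (to (xs⇔S _) (proj₁ (∈-filter⁻ parent∈? {xs = xs} v∈both))))
    (λ {v} → mk⇔ (⇒ v ∘ to (∈-allChildren xs)) (from (∈-allChildren xs) ∘ ⇐ v))
    where
    ⇒ : ∀ v → parent v ∈ xs → v ∈ ds ++ both
    ⇒ v p∈xs with v ∈? xs
    ... | yes v∈xs = ∈-++⁺ʳ ds (∈-filter⁺ parent∈? v∈xs p∈xs)
    ... | no  v∉xs = ∈-++⁺ˡ (from (ds⇔ v) (v∉xs ∘ from (xs⇔S v) , to (xs⇔S _) p∈xs))
    ⇐ : ∀ v → v ∈ ds ++ both → parent v ∈ xs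
    ⇐ v v∈ with ∈-++⁻ ds v∈
    ... | inj₁ v∈ds   = from (xs⇔S _) (proj₂ (to (ds⇔ v) v∈ds))
    ... | inj₂ v∈both = proj₂ (∈-filter⁻ parent∈? {xs = xs} v∈both)

level-≥1 : ∀ vs → All (1 ≤_) (map level vs)
level-≥1 vs = All.map⁺ (All.universal (λ _ → s≤s z≤n) vs)

length-filter-¬ : ∀ {A : Set} {P : Pred A 0ℓ} (P? : Decidable P) xs →
  length (filter P? xs) + length (filter (¬? ∘ P?) xs) ≡ length xs
length-filter-¬ P? []       = refl
length-filter-¬ P? (x ∷ xs) with P? x
... | yes _ = cong suc (length-filter-¬ P? xs)
... | no  _ = trans (+-suc _ _) (cong suc (length-filter-¬ P? xs))

cut⇒SABP : ∀ {n k} (S : Pred Vertex 0ℓ) → Card S n → Card (Cut S) k →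
           ∃ λ P → ∃ λ N → IsSABP n P N × parts P N ≡ k
cut⇒SABP S (xs , xs! , refl , xs⇔S) (cs , cs! , refl , cs⇔) =
  map level us , map level ds ,
  (level-≥1 us , level-≥1 ds , cut-identity (xs! , xs⇔S) (us! , us⇔) (ds! , ds⇔)) ,
  trans (cong₂ _+_ (length-map level us) (length-map level ds)) (length-filter-¬ S? cs)
  where
  open import Data.List.Membership.DecPropositional _≟ⱽ_ using (_∈?_)

  -- S is an arbitrary predicate; its enumeration makes it decidable, so that the list of the cut
  -- can be split.
  S? : Decidable S
  S? v with v ∈? xs
  ... | yes v∈xs = yes (to (xs⇔S v) v∈xs)
  ... | no  v∉xs = no (v∉xs ∘ from (xs⇔S v))

  us ds : List Vertex
  us = filter S? cs
  ds = filter (¬? ∘ S?) cs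

  us! : Unique us
  us! = Unique.filter⁺ S? cs!

  ds! : Unique ds
  ds! = Unique.filter⁺ (¬? ∘ S?) cs!

  us⇔ : ∀ v → v ∈ us ⇔ Up S v
  us⇔ v = mk⇔ ⇒ (λ up → ∈-filter⁺ S? (from (cs⇔ v) (inj₁ up)) (proj₁ up))
    where
    ⇒ : v ∈ us → Up S v
    ⇒ v∈us with ∈-filter⁻ S? {xs = cs} v∈us
    ... | v∈cs , Sv with to (cs⇔ v) v∈cs
    ...   | inj₁ up       = up
    ...   | inj₂ (¬Sv , _) = contradiction Sv ¬Sv

  ds⇔ : ∀ v → v ∈ ds ⇔ Down S v
  ds⇔ v = mk⇔ ⇒ (λ down → ∈-filter⁺ (¬? ∘ S?) (from (cs⇔ v) (inj₂ down)) (proj₁ down))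
    where
    ⇒ : v ∈ ds → Down S v
    ⇒ v∈ds with ∈-filter⁻ (¬? ∘ S?) {xs = cs} v∈ds
    ... | v∈cs , ¬Sv with to (cs⇔ v) v∈cs
    ...   | inj₁ (Sv , _) = contradiction Sv ¬Sv
    ...   | inj₂ down     = down

-- Forests of one trimmed tree and complete trees

⊑-parent : ∀ v → v ⊑ parent v
⊑-parent _ = refl ◅ ε

⊑-level : ∀ {w v} → w ⊑ v → level w ≤ level v
⊑-level ε          = ≤-refl
⊑-level (refl ◅ p) = ≤-trans (n≤1+n _) (⊑-level p)

parent⋢ : ∀ {v} → ¬ parent v ⊑ v
parent⋢ p = 1+n≰n (⊑-level p)

⊑⇒≡∨parent : ∀ {w v} → w ⊑ v → w ≡ v ⊎ parent w ⊑ v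
⊑⇒≡∨parent ε          = inj₁ refl
⊑⇒≡∨parent (refl ◅ p) = inj₂ p

⊑-total : ∀ {w u v} → w ⊑ u → w ⊑ v → u ⊑ v ⊎ v ⊑ u
⊑-total ε          q          = inj₁ q
⊑-total p          ε          = inj₂ p
⊑-total (refl ◅ p) (refl ◅ q) = ⊑-total p q

⊑-antisym-level : ∀ {w v} → w ⊑ v → level v ≤ level w → w ≡ v
⊑-antisym-level p v≤w with ⊑⇒≡∨parent p
... | inj₁ eq = eq
... | inj₂ q  = contradiction (≤-trans (⊑-level q) v≤w) 1+n≰n

⊑-ancestor-unique : ∀ {w u v} → w ⊑ u → w ⊑ v → level u ≡ level v → u ≡ v
⊑-ancestor-unique p q eq with ⊑-total p q
... | inj₁ u⊑v = ⊑-antisym-level u⊑v (≤-reflexive (sym eq))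
... | inj₂ v⊑u = sym (⊑-antisym-level v⊑u (≤-reflexive eq))

-- Climbs from w to successive parents. The fuel d satisfies `level v ≤ d + level w`, so when it
-- runs out w is no lower than v and only w = v remains possible.
_⊑?_ : ∀ w v → Dec (w ⊑ v)
w ⊑? v = climb w (level v) (m≤m+n (level v) (level w))
  where
  climb : ∀ w d → level v ≤ d + level w → Dec (w ⊑ v)
  climb w d _ with w ≟ⱽ v
  climb w d       _   | yes refl = yes ε
  climb w zero    v≤w | no w≢v   = no λ p → w≢v (⊑-antisym-level p v≤w)
  climb w (suc d) v≤  | no w≢v
    with climb (parent w) d (≤-trans v≤ (≤-reflexive (sym (+-suc d (level w)))))
  ... | yes p = yes (refl ◅ p)
  ... | no ¬p = no λ q → [ w≢v , ¬p ]′ (⊑⇒≡∨parent q)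

descendantsOf : ℕ → ℕ → List Vertex
descendantsOf zero    j = (zero , j) ∷ []
descendantsOf (suc k) j = (suc k , j) ∷ descendantsOf k (2 * j) ++ descendantsOf k (suc (2 * j))

descendants : Vertex → List Vertex
descendants (k , j) = descendantsOf k j

self∈descendants : ∀ k j → (k , j) ∈ descendantsOf k j
self∈descendants zero    _ = here refl
self∈descendants (suc _) _ = here refl

descendants-closed : ∀ k j {w} → parent w ∈ descendantsOf k j → w ∈ descendantsOf k j
descendants-closed zero j (here ())
descendants-closed (suc k) j {w} (here p≡v) with subst (λ u → w ∈ children u) p≡v (∈-children⁺ w)
... | here refl         = there (∈-++⁺ˡ (self∈descendants k _))
... | there (here refl) = there (∈-++⁺ʳ (descendantsOf k (2 * j)) (self∈descendants k _))
descendants-closed (suc k) j (there p∈) with ∈-++⁻ (descendantsOf k (2 * j)) p∈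
... | inj₁ p∈ˡ = there (∈-++⁺ˡ (descendants-closed k _ p∈ˡ))
... | inj₂ p∈ʳ = there (∈-++⁺ʳ (descendantsOf k (2 * j)) (descendants-closed k _ p∈ʳ))

⊑⇒∈descendants : ∀ {w v} → w ⊑ v → w ∈ descendants v
⊑⇒∈descendants {w} ε      = self∈descendants _ _
⊑⇒∈descendants (refl ◅ p) = descendants-closed _ _ (⊑⇒∈descendants p)

Connected-sym : ∀ {S u v} → Connected S u v → Connected S v u
Connected-sym = Star.reverse λ (Su , Sv , uv) → Sv , Su , [ inj₂ , inj₁ ]′ uv

Connected-mono : ∀ {S T} → (∀ {u} → S u → T u) → ∀ {u v} → Connected S u v → Connected T u v
Connected-mono S⊆T = Star.map λ (Su , Sv , uv) → S⊆T Su , S⊆T Sv , uv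

Connected-up : ∀ {S u v} → (∀ {x} → S x → parent x ⊑ v → S (parent x)) →
               S u → u ⊑ v → Connected S u v
Connected-up up Su ε          = ε
Connected-up up Su (refl ◅ p) = (Su , up Su p , inj₂ refl) ◅ Connected-up up (up Su p) p

-- The form to which C-trees are brought: `ds` holds the roots of the deleted subtrees.
Trimmed : Vertex → List Vertex → Pred Vertex 0ℓ
Trimmed v ds w = w ⊑ v × ¬ Any (w ⊑_) ds

Subtrees : List Vertex → Pred Vertex 0ℓ
Subtrees roots w = Any (w ⊑_) roots

Incomparable : Vertex → Vertex → Set
Incomparable u v = ¬ u ⊑ v × ¬ v ⊑ u

Trimmed-up : ∀ {v ds x} → Trimmed v ds x → parent x ⊑ v → Trimmed v ds (parent x)
Trimmed-up (_ , x∉) p⊑v = p⊑v , λ p∈ → x∉ (Any.map (⊑-parent _ ◅◅_) p∈)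

Separated-sym : ∀ {S T} → Separated S T → Separated T S
Separated-sym sep Tu Sv =
  proj₁ (sep Sv Tu) ∘ sym , λ uv → proj₂ (sep Sv Tu) ([ inj₂ , inj₁ ]′ uv)

Up-Trimmed⁻ : ∀ {v ds u} → Up (Trimmed v ds) u → u ≡ v
Up-Trimmed⁻ (c@(u⊑v , _) , ¬c) with ⊑⇒≡∨parent u⊑v
... | inj₁ u≡v = u≡v
... | inj₂ p⊑v = contradiction (Trimmed-up c p⊑v) ¬c

Down-Trimmed⁻ : ∀ {v ds u} → Down (Trimmed v ds) u → u ∈ ds
Down-Trimmed⁻ {v} {ds} {u} (¬c , p⊑v , p∉) with Any.any? (u ⊑?_) ds
... | no  u∉ = contradiction (⊑-parent u ◅◅ p⊑v , u∉) ¬c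
... | yes u∈ with find u∈
...   | d , d∈ds , u⊑d with ⊑⇒≡∨parent u⊑d
...     | inj₁ refl = d∈ds
...     | inj₂ p⊑d  = contradiction (lose d∈ds p⊑d) p∉

-- Bounding `parent d` by v puts each d strictly below v, so v itself survives the trimming.
Up-Trimmed⁺ : ∀ {v ds} → All (λ d → parent d ⊑ v) ds → Up (Trimmed v ds) v
Up-Trimmed⁺ {v} below = (ε , v∉) , λ (p⊑v , _) → parent⋢ p⊑v
  where
  v∉ : ¬ Any (v ⊑_) _
  v∉ v∈ with find v∈
  ... | d , d∈ , v⊑d = parent⋢ (All.lookup below d∈ ◅◅ v⊑d)

-- If `parent d` were in a deleted subtree, with root e, then d would be below e; incomparability
-- forces e = d, and no parent is below its child.
Down-Trimmed⁺ : ∀ {v ds d} → All (λ d → parent d ⊑ v) ds → AllPairs Incomparable ds →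
                d ∈ ds → Down (Trimmed v ds) d
Down-Trimmed⁺ {ds = ds} {d} below anti d∈ds =
  (λ (_ , d∉) → d∉ (lose d∈ds ε)) , All.lookup below d∈ds , p∉
  where
  p∉ : ¬ Any (parent d ⊑_) ds
  p∉ p∈ with find p∈
  ... | e , e∈ds , p⊑e with ∈-AllPairs₂ anti d∈ds e∈ds
  ...   | inj₁ refl              = parent⋢ p⊑e
  ...   | inj₂ (inj₁ (d⋢e , _)) = d⋢e (⊑-parent d ◅◅ p⊑e)
  ...   | inj₂ (inj₂ (_ , d⋢e)) = d⋢e (⊑-parent d ◅◅ p⊑e)

Up-Subtrees⁻ : ∀ {roots u} → Up (Subtrees roots) u → u ∈ roots
Up-Subtrees⁻ (u∈ , p∉) with find u∈
... | ρ , ρ∈ , u⊑ρ with ⊑⇒≡∨parent u⊑ρ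
...   | inj₁ refl = ρ∈
...   | inj₂ p⊑ρ  = contradiction (lose ρ∈ p⊑ρ) p∉

-- Each subtree contains all children of its vertices, so the cut edges of complete trees lie above
-- their roots.
Down-Subtrees⁻ : ∀ {roots u} → ¬ Down (Subtrees roots) u
Down-Subtrees⁻ (u∉ , p∈) = u∉ (Any.map (⊑-parent _ ◅◅_) p∈)

SeparatedSubtrees : List Vertex → Set
SeparatedSubtrees = AllPairs (λ u v → Separated (Subtree u) (Subtree v))

same-root : ∀ {roots ρ σ x y} → SeparatedSubtrees roots → ρ ∈ roots → σ ∈ roots →
            x ⊑ ρ → y ⊑ σ → Adjacent x y → ρ ≡ σ
same-root sep ρ∈ σ∈ x⊑ρ y⊑σ xy with ∈-AllPairs₂ sep ρ∈ σ∈
... | inj₁ ρ≡σ        = ρ≡σ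
... | inj₂ (inj₁ ρσ) = contradiction xy (proj₂ (ρσ x⊑ρ y⊑σ))
... | inj₂ (inj₂ σρ) = contradiction ([ inj₂ , inj₁ ]′ xy) (proj₂ (σρ y⊑σ x⊑ρ))

Up-Subtrees⁺ : ∀ {roots ρ} → SeparatedSubtrees roots → ρ ∈ roots → Up (Subtrees roots) ρ
Up-Subtrees⁺ {roots} {ρ} sep ρ∈ = lose ρ∈ ε , p∉
  where
  p∉ : ¬ Subtrees roots (parent ρ)
  p∉ p∈ with find p∈
  ... | σ , σ∈ , p⊑σ with refl ← same-root sep ρ∈ σ∈ ε p⊑σ (inj₂ refl) = parent⋢ p⊑σ

-- Because the trees are separated, the outer end of a cut edge of one tree lies in no other tree,
-- so the cuts of the C-tree and of the complete trees add up.
module TrimmedForest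
  {v ds roots} {C F S : Pred Vertex 0ℓ}
  (C≐ : C ≐ Trimmed v ds) (F≐ : F ≐ Subtrees roots) (S≐ : S ≐ (C ∪ F))
  (below : All (λ d → parent d ⊑ v) ds) (antichain : AllPairs Incomparable ds)
  (separated : SeparatedSubtrees roots) (C⋮F : Separated C F)
  where

  private
    S⇒ : ∀ {u} → S u → Trimmed v ds u ⊎ Subtrees roots u
    S⇒ Su with proj₁ S≐ Su
    ... | inj₁ Cu = inj₁ (proj₁ C≐ Cu)
    ... | inj₂ Fu = inj₂ (proj₁ F≐ Fu)

    C⇒S : ∀ {u} → Trimmed v ds u → S u
    C⇒S = proj₂ S≐ ∘ inj₁ ∘ proj₂ C≐

    F⇒S : ∀ {u} → Subtrees roots u → S u
    F⇒S = proj₂ S≐ ∘ inj₂ ∘ proj₂ F≐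

    sep : Separated (Trimmed v ds) (Subtrees roots)
    sep Cu Fv = C⋮F (proj₂ C≐ Cu) (proj₂ F≐ Fv)

    v∈C : Trimmed v ds v
    v∈C = proj₁ (Up-Trimmed⁺ below)

  ups : Enumerates (v ∷ roots) (Up S)
  ups = (v∉roots ∷ roots!) , λ u → mk⇔ (⇒ u) (⇐ u)
    where
    v∉roots : All (v ≢_) roots
    v∉roots = All.tabulate λ ρ∈ → proj₁ (sep v∈C (lose ρ∈ ε))

    roots! : Unique roots
    roots! = AllPairs.map (λ ρσ → proj₁ (ρσ ε ε)) separated

    ⇒ : ∀ u → u ∈ v ∷ roots → Up S u
    ⇒ u (here refl) = C⇒S v∈C , λ Sp → [ proj₂ (Up-Trimmed⁺ below)
                                       , (λ Fp → proj₂ (sep v∈C Fp) (inj₂ refl)) ]′ (S⇒ Sp)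
    ⇒ u (there u∈) with Up-Subtrees⁺ separated u∈
    ... | Fu , ¬Fp = F⇒S Fu , λ Sp → [ (λ Cp → proj₂ (sep Cp Fu) (inj₁ refl)) , ¬Fp ]′ (S⇒ Sp)

    ⇐ : ∀ u → Up S u → u ∈ v ∷ roots
    ⇐ u (Su , ¬Sp) with S⇒ Su
    ... | inj₁ Cu = here (Up-Trimmed⁻ (Cu , ¬Sp ∘ C⇒S))
    ... | inj₂ Fu = there (Up-Subtrees⁻ (Fu , ¬Sp ∘ F⇒S))

  downs : Enumerates ds (Down S)
  downs = AllPairs.map (λ { (d⋢e , _) refl → d⋢e ε }) antichain , λ u → mk⇔ (⇒ u) (⇐ u)
    where
    ⇒ : ∀ u → u ∈ ds → Down S u
    ⇒ u u∈ with Down-Trimmed⁺ below antichain u∈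
    ... | ¬Cu , Cp = (λ Su → [ ¬Cu , (λ Fu → proj₂ (sep Cp Fu) (inj₁ refl)) ]′ (S⇒ Su)) , C⇒S Cp

    ⇐ : ∀ u → Down S u → u ∈ ds
    ⇐ u (¬Su , Sp) with S⇒ Sp
    ... | inj₁ Cp = Down-Trimmed⁻ (¬Su ∘ C⇒S , Cp)
    ... | inj₂ Fp = contradiction (¬Su ∘ F⇒S , Fp) (Down-Subtrees⁻ {roots})

  S? : Decidable S
  S? u = map′ [ C⇒S , F⇒S ]′ S⇒
    (((u ⊑? v) ×-dec ¬? (Any.any? (u ⊑?_) ds)) ⊎-dec Any.any? (u ⊑?_) roots)

  -- Every element lies below v or a root, which leaves finitely many candidates. `deduplicate`
  -- takes the place of a proof that they are distinct.
  elements : List Vertex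
  elements = deduplicate _≟ⱽ_ (filter S? (concatMap descendants (v ∷ roots)))

  elements-enumerate : Enumerates elements S
  elements-enumerate = UniqueDec.deduplicate-! _≟ⱽ_ _ , λ u → mk⇔
    (λ u∈ → proj₂ (∈-filter⁻ S? {xs = concatMap descendants (v ∷ roots)}
                             (∈-deduplicate⁻ _≟ⱽ_ _ u∈)))
    (λ Su → ∈-deduplicate⁺ _≟ⱽ_
              (∈-filter⁺ S? (∈-concatMap⁺ descendants (Any.map ⊑⇒∈descendants (inSubtree Su))) Su))
    where
    inSubtree : ∀ {u} → S u → Any (u ⊑_) (v ∷ roots)
    inSubtree Su with S⇒ Su
    ... | inj₁ (u⊑v , _) = here u⊑v
    ... | inj₂ Fu        = there Fu

  size : length elements + levelSum ds ≡ levelSum (v ∷ roots)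
  size = cut-identity elements-enumerate ups downs

  card-cut : Card (Cut S) (suc (length roots) + length ds)
  card-cut = (v ∷ roots) ++ ds ,
    Unique.++⁺ (proj₁ ups) (proj₁ downs)
      (λ {u} (u∈ups , u∈downs) →
        proj₁ (to (proj₂ downs u) u∈downs) (proj₁ (to (proj₂ ups u) u∈ups))) ,
    length-++ (v ∷ roots) ,
    λ u → mk⇔
      (λ u∈ → [ inj₁ ∘ to (proj₂ ups u) , inj₂ ∘ to (proj₂ downs u) ]′ (∈-++⁻ (v ∷ roots) u∈))
      [ ∈-++⁺ˡ ∘ from (proj₂ ups u) , ∈-++⁺ʳ (v ∷ roots) ∘ from (proj₂ downs u) ]′

  -- By separation, a path in S that starts below ρ can step neither into the C-tree nor below
  -- another root.
  subtree-closed : ∀ {ρ x y} → ρ ∈ roots → x ⊑ ρ → Connected S x y → y ⊑ ρ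
  subtree-closed ρ∈ x⊑ρ ε = x⊑ρ
  subtree-closed ρ∈ x⊑ρ ((_ , Sz , xz) ◅ zs) with S⇒ Sz
  ... | inj₁ Cz = contradiction xz (proj₂ (Separated-sym sep (lose ρ∈ x⊑ρ) Cz))
  ... | inj₂ Fz with find Fz
  ...   | σ , σ∈ , z⊑σ with refl ← same-root separated ρ∈ σ∈ x⊑ρ z⊑σ xz =
          subtree-closed ρ∈ z⊑σ zs

  allButOneComplete : AllButOneComplete S
  allButOneComplete = v , C⇒S v∈C , classify
    where
    toRoot : ∀ {ρ u} → ρ ∈ roots → u ⊑ ρ → Connected S u ρ
    toRoot ρ∈ u⊑ρ =
      Connected-mono (λ x⊑ρ → F⇒S (lose ρ∈ x⊑ρ)) (Connected-up (λ _ p⊑ρ → p⊑ρ) u⊑ρ u⊑ρ)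

    classify : ∀ u → S u → Connected S v u ⊎ IsCompleteBinaryTree (Component S u)
    classify u Su with S⇒ Su
    ... | inj₁ Cu =
          inj₁ (Connected-sym (Connected-mono C⇒S (Connected-up Trimmed-up Cu (proj₁ Cu))))
    ... | inj₂ Fu with find Fu
    -- The component is the full subtree of ρ, complete with its leaves at level 1.
    ...   | ρ , ρ∈ , u⊑ρ = inj₂ (ρ , 1 , ≤-refl , s≤s z≤n ,
            (λ u~w → subtree-closed ρ∈ u⊑ρ u~w , s≤s z≤n) ,
            (λ (w⊑ρ , _) → toRoot ρ∈ u⊑ρ ◅◅ Connected-sym (toRoot ρ∈ w⊑ρ)))

-- C-trees as trimmed trees

Unique-resp-↭ : ∀ {A : Set} {xs ys : List A} → xs ↭ ys → Unique xs → Unique ys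
Unique-resp-↭ {A} = Setoid↭.Unique-resp-↭ (setoid A) ∘ ↭⇒↭ₛ

descending : ∀ {k ks} → GreedyList (k ∷ ks) → All (_≤ k) ks
descending {ks = []} _ = []
descending {ks = j ∷ js} (cons _ ks≤k g) = j≤k ∷ All.map (λ i≤j → ≤-trans i≤j j≤k) (descending g)
  where j≤k = ν-cancel-≤ (≤-trans (m≤m+n _ (νSum js)) ks≤k)

-- The two cases in the definition of the C-tree: no repetition, or only the least part t repeated,
-- exactly twice.
data Shape (ks : List ℕ) : Set where
  distinct : Unique ks → Shape ks
  repeated : ∀ t M → ks ↭ t ∷ t ∷ M → Unique M → All (t <_) M → Shape ks

Shape-resp-↭ : ∀ {ks ls} → ks ↭ ls → Shape ls → Shape ks
Shape-resp-↭ ks↭ls (distinct ls!) = distinct (Unique-resp-↭ (↭-sym ks↭ls) ls!)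
Shape-resp-↭ ks↭ls (repeated t M ls↭ M! t<M) = repeated t M (↭-trans ks↭ls ls↭) M! t<M

-- If the second part equals k, it uses up the bound ν k on the tail, so nothing follows it.
strict∨double : ∀ {k ks} → GreedyList (k ∷ ks) → All (_< k) ks ⊎ ks ≡ k ∷ []
strict∨double {ks = []} _ = inj₁ []
strict∨double {k} {j ∷ js} g@(cons _ ks≤k g′) with m≤n⇒m<n∨m≡n (All.head (descending g))
... | inj₁ j<k = inj₁ (j<k ∷ All.map (λ i≤j → ≤-<-trans i≤j j<k) (descending g′))
strict∨double {k} {j ∷ []}     _ | inj₂ refl = inj₂ refl
strict∨double {k} {j ∷ i ∷ is} (cons _ ks≤k (cons _ _ (cons 1≤i _ _))) | inj₂ refl =
  contradiction ks≤k (<⇒≱ (m<m+n (ν k) (≤-trans (ν-positive 1≤i) (m≤m+n (ν i) (νSum is)))))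

greedyShape : ∀ {ks} → GreedyList ks → Shape ks
greedyShape [] = distinct []
greedyShape {k ∷ ks} g@(cons _ _ g′) with strict∨double g
... | inj₂ refl = repeated k [] ↭-refl [] []
... | inj₁ ks<k with greedyShape g′
...   | distinct ks! = distinct (All.map >⇒≢ ks<k ∷ ks!)
...   | repeated t M ks↭ M! t<M with ↭.All-resp-↭ ks↭ ks<k
...     | t<k ∷ _ ∷ M<k = repeated t (k ∷ M)
            (↭-trans (prep k ks↭) (↭-trans (swap k t ↭-refl) (prep t (swap k t ↭-refl))))
            (All.map >⇒≢ M<k ∷ M!) (t<k ∷ t<M)

pathEnd-distinct : ∀ {N} → Unique N → pathEnd N ≡ 1
pathEnd-distinct {[]}     _  = refl
pathEnd-distinct {x ∷ xs} N! =
  cong (λ b → if b then 1 else suc (min x xs)) (dec-true (unique? _≟_ (x ∷ xs)) N!)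

pathEnd-repeated : ∀ {N t M} → N ↭ t ∷ t ∷ M → All (t <_) M → pathEnd N ≡ suc t
pathEnd-repeated {[]} N↭ _ = contradiction (↭-sym N↭) ↭.¬x∷xs↭[]
pathEnd-repeated {N@(x ∷ xs)} {t} {M} N↭ t<M =
  trans (cong (λ b → if b then 1 else suc (min x xs)) (dec-false (unique? _≟_ N) ¬N!))
        (cong suc (≤-antisym (min≤v⁺ x xs (min≤t (↭.∈-resp-↭ (↭-sym N↭) (here refl))))
                             (v≤min⁺ (All.head t≤N) (All.tail t≤N))))
  where
  t≤N : All (t ≤_) N
  t≤N = ↭.All-resp-↭ (↭-sym N↭) (≤-refl ∷ ≤-refl ∷ All.map <⇒≤ t<M)

  min≤t : t ∈ N → x ≤ t ⊎ Any (_≤ t) xs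
  min≤t (here refl) = inj₁ ≤-refl
  min≤t (there t∈)  = inj₂ (lose t∈ ≤-refl)

  ¬N! : ¬ Unique N
  ¬N! N! = All.head (AllPairs.head (Unique-resp-↭ N↭ N!)) refl

-- The path of the C-tree

iterate-suc : ∀ {A : Set} (f : A → A) x n → iterate f x (suc n) ≡ f (iterate f x n)
iterate-suc f x zero    = refl
iterate-suc f x (suc n) = iterate-suc f (f x) n

level-left : ∀ u {j} → 1 ≤ j → level u ≡ suc j → level (left u) ≡ j
level-left (suc k , _) _ refl = refl
level-left (zero , _) () refl

level-right : ∀ u {j} → 1 ≤ j → level u ≡ suc j → level (right u) ≡ j
level-right (suc k , _) _ refl = refl
level-right (zero , _) () refl

module _ (N : List ℕ) (v : Vertex) where

  private
    v[_] : ℕ → Vertex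
    v[_] = path N v

  path-suc : ∀ {j} → j < level v → v[ j ] ≡ pathStep N v[ suc j ]
  path-suc {j} j<r =
    -- Here `level v ∸ j` is the successor of `proj₁ v ∸ j`, the number of steps down to level j +
    -- 1.
    trans (cong (iterate (pathStep N) v) (+-∸-assoc 1 (s≤s⁻¹ j<r)))
          (iterate-suc (pathStep N) v (proj₁ v ∸ j))

  path-top : v[ level v ] ≡ v
  path-top = cong (iterate (pathStep N) v) (n∸n≡0 (level v))

  level-pathStep : ∀ u {j} → 1 ≤ j → level u ≡ suc j → level (pathStep N u) ≡ j
  level-pathStep u 1≤j eq with does (mem? _≟_ (pred (level u)) N)
  ... | true  = level-left u 1≤j eq
  ... | false = level-right u 1≤j eq

  parent-pathStep : ∀ u → 1 < level u → parent (pathStep N u) ≡ u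
  parent-pathStep u 1<u with does (mem? _≟_ (pred (level u)) N)
  ... | true  = parent-left 1<u
  ... | false = parent-right 1<u

  path-level : ∀ {j} → 1 ≤ j → j ≤ level v → level v[ j ] ≡ j
  path-level {j} 1≤j j≤r = go (level v ∸ j) (m∸n+n≡m j≤r) 1≤j
    where
    go : ∀ d {j} → d + j ≡ level v → 1 ≤ j → level (iterate (pathStep N) v d) ≡ j
    go zero    eq _ = sym eq
    go (suc d) {j} eq 1≤j rewrite iterate-suc (pathStep N) v d =
      level-pathStep (iterate (pathStep N) v d) 1≤j (go d (trans (+-suc d j) eq) (s≤s z≤n))

  path-parent : ∀ {j} → 1 ≤ j → j < level v → parent v[ j ] ≡ v[ suc j ]
  path-parent 1≤j j<r = trans (cong parent (path-suc j<r))
    (parent-pathStep _ (subst (1 <_) (sym (path-level (s≤s z≤n) j<r)) (s≤s 1≤j)))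

  path-⊑ : ∀ {i j} → 1 ≤ i → i ≤ j → j ≤ level v → v[ i ] ⊑ v[ j ]
  path-⊑ {i} {j} 1≤i i≤j j≤r = go (j ∸ i) 1≤i (m∸n+n≡m i≤j)
    where
    go : ∀ d {i} → 1 ≤ i → d + i ≡ j → v[ i ] ⊑ v[ j ]
    go zero    _ refl = ε
    go (suc d) {i} 1≤i eq = sym (path-parent 1≤i i<r) ◅ go d (s≤s z≤n) (trans (+-suc d i) eq)
      where i<r = ≤-trans (subst (i <_) eq (s≤s (m≤n+m i d))) j≤r

  path-left : ∀ {j} → j ∈ N → 1 ≤ j → j < level v → v[ j ] ≡ left v[ suc j ]
  path-left {j} j∈N 1≤j j<r = trans (path-suc j<r)
    (cong (λ b → if b then left v[ suc j ] else right v[ suc j ])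
      (trans (cong (λ l → does (mem? _≟_ (pred l) N)) (path-level (s≤s z≤n) j<r))
             (dec-true (mem? _≟_ j N) j∈N)))

  path-right : ∀ {j} → j ∉ N → 1 ≤ j → j < level v → v[ j ] ≡ right v[ suc j ]
  path-right {j} j∉N 1≤j j<r = trans (path-suc j<r)
    (cong (λ b → if b then left v[ suc j ] else right v[ suc j ])
      (trans (cong (λ l → does (mem? _≟_ (pred l) N)) (path-level (s≤s z≤n) j<r))
             (dec-false (mem? _≟_ j N) j∉N)))

  -- `Deleted` only records that the path vertex is a left child. If j were not in N, it would be
  -- the right child, a different vertex.
  turns-left⇒∈ : ∀ {j} → 1 ≤ j → j < level v → v[ j ] ≡ left v[ suc j ] → j ∈ N
  turns-left⇒∈ {j} 1≤j j<r eq with mem? _≟_ j N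
  ... | yes j∈N = j∈N
  ... | no  j∉N = contradiction (trans (sym eq) (path-right j∉N 1≤j j<r))
                                (left≢right v[ suc j ] v[ suc j ])

-- Presents the C-tree as a trimmed subtree: one deleted root for each part of N, counted with
-- multiplicity, at the level of that part.
record CTreeCuts (N : List ℕ) (v : Vertex) : Set where
  field
    cuts      : List Vertex
    levels    : map level cuts ↭ N
    below     : All (λ d → parent d ⊑ v) cuts
    antichain : AllPairs Incomparable cuts
    deleted   : ∀ w → Deleted N v w ⇔ Any (w ⊑_) cuts

AllPairs-map : ∀ {A B : Set} {P : Pred A 0ℓ} {R : B → B → Set} {f : A → B} {xs} →
  (∀ {x y} → P x → P y → x ≢ y → R (f x) (f y)) → All P xs → Unique xs → AllPairs R (map f xs)
AllPairs-map r [] [] = []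
AllPairs-map r (px ∷ pxs) (x∉ ∷ xs!) =
  All.map⁺ (All.zipWith (λ (py , x≢y) → r px py x≢y) (pxs , x∉)) ∷ AllPairs-map r pxs xs!

module _ {N : List ℕ} {v : Vertex} (1≤N : All (1 ≤_) N) (N<r : All (_< level v) N) where

  private
    v[_] : ℕ → Vertex
    v[_] = path N v

    -- For j in N this right child is the root of a deleted subtree at level j, and so stands for
    -- the part j.
    sibling : ℕ → Vertex
    sibling j = right v[ suc j ]

    1≤ : ∀ {j} → j ∈ N → 1 ≤ j
    1≤ = All.lookup 1≤N

    <r : ∀ {j} → j ∈ N → j < level v
    <r = All.lookup N<r

    sibling-level : ∀ {j} → j ∈ N → level (sibling j) ≡ j
    sibling-level {j} j∈N = level-right v[ suc j ] (1≤ j∈N) (path-level N v (s≤s z≤n) (<r j∈N))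

    sibling-parent : ∀ {j} → j ∈ N → parent (sibling j) ≡ v[ suc j ]
    sibling-parent j∈N =
      parent-right (subst (1 <_) (sym (path-level N v (s≤s z≤n) (<r j∈N))) (s≤s (1≤ j∈N)))

    path-⊑-v : ∀ {j} → 1 ≤ j → j ≤ level v → v[ j ] ⊑ v
    path-⊑-v {j} 1≤j j≤r = subst (v[ j ] ⊑_) (path-top N v) (path-⊑ N v 1≤j j≤r ≤-refl)

    sibling-below : ∀ {j} → j ∈ N → parent (sibling j) ⊑ v
    sibling-below j∈N = subst (_⊑ v) (sym (sibling-parent j∈N)) (path-⊑-v (s≤s z≤n) (<r j∈N))

    -- The path vertex and its sibling are distinct but of the same level; if x below the former
    -- were comparable with the latter, the two would be equal.
    sibling-incomparable : ∀ {j x} → j ∈ N → x ⊑ v[ j ] → Incomparable x (sibling j)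
    sibling-incomparable {j} j∈N x⊑ =
      (λ x⊑s → v≢s (⊑-ancestor-unique x⊑ x⊑s v~s)) ,
      (λ s⊑x → v≢s (sym (⊑-antisym-level (s⊑x ◅◅ x⊑) (≤-reflexive v~s))))
      where
      v~s : level v[ j ] ≡ level (sibling j)
      v~s = trans (path-level N v (1≤ j∈N) (<⇒≤ (<r j∈N))) (sym (sibling-level j∈N))

      v≢s : v[ j ] ≢ sibling j
      v≢s eq = left≢right v[ suc j ] v[ suc j ]
        (trans (sym (path-left N v j∈N (1≤ j∈N) (<r j∈N))) eq)

    -- A lower sibling hangs from the path at level i + 1, at most j. This reduces comparing two
    -- siblings to comparing a sibling with a vertex below the path.
    sibling-⊑ : ∀ {i j} → i ∈ N → j ∈ N → i < j → sibling i ⊑ v[ j ]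
    sibling-⊑ i∈N j∈N i<j =
      sym (sibling-parent i∈N) ◅ path-⊑ N v (s≤s z≤n) i<j (<⇒≤ (<r j∈N))

    Incomparable-sym : ∀ {x y} → Incomparable x y → Incomparable y x
    Incomparable-sym (x⋢y , y⋢x) = y⋢x , x⋢y

    siblings-incomparable : ∀ {i j} → i ∈ N → j ∈ N → i ≢ j → Incomparable (sibling i) (sibling j)
    siblings-incomparable i∈N j∈N i≢j with ≤-total _ _
    ... | inj₁ i≤j = sibling-incomparable j∈N (sibling-⊑ i∈N j∈N (≤∧≢⇒< i≤j i≢j))
    ... | inj₂ j≤i = Incomparable-sym
          (sibling-incomparable i∈N (sibling-⊑ j∈N i∈N (≤∧≢⇒< j≤i (≢-sym i≢j))))

    sibling-levels : ∀ {M} → All (_∈ N) M → map level (map sibling M) ≡ M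
    sibling-levels {M} M⊆N = trans (sym (map-∘ M)) (map-id-local (All.map sibling-level M⊆N))

    side-sibling : ∀ {w j} → j ∈ N → pathEnd N ≤ j → w ⊑ sibling j → Deleted N v w
    side-sibling {j = j} j∈N h≤j w⊑ = side j h≤j (<r j∈N) (path-left N v j∈N (1≤ j∈N) (<r j∈N)) w⊑

  distinctCuts : Unique N → CTreeCuts N v
  distinctCuts N! = record
    { cuts      = map sibling N
    ; levels    = ↭-reflexive (sibling-levels N⊆N)
    ; below     = All.map⁺ (All.map sibling-below N⊆N)
    ; antichain = AllPairs-map siblings-incomparable N⊆N N!
    ; deleted   = λ w → mk⇔ ⇒ ⇐
    }
    where
    N⊆N : All (_∈ N) N
    N⊆N = All.tabulate λ j∈N → j∈N

    h≡1 : pathEnd N ≡ 1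
    h≡1 = pathEnd-distinct N!

    ⇒ : ∀ {w} → Deleted N v w → Any (w ⊑_) (map sibling N)
    ⇒ (side j h≤j j<r eq w⊑) =
      Any.map⁺ (lose (turns-left⇒∈ N v (subst (_≤ j) h≡1 h≤j) j<r eq) w⊑)
    ⇒ (end h≢1 _) = contradiction h≡1 h≢1

    ⇐ : ∀ {w} → Any (w ⊑_) (map sibling N) → Deleted N v w
    ⇐ w∈ with find (Any.map⁻ w∈)
    ... | j , j∈N , w⊑ = side-sibling j∈N (subst (_≤ j) (sym h≡1) (1≤ j∈N)) w⊑

  -- The path stops at e, of level t + 1, and the two children of e account for the two copies of t;
  -- the right one is `sibling t` by definition.
  repeatedCuts : ∀ t M → N ↭ t ∷ t ∷ M → Unique M → All (t <_) M → CTreeCuts N v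
  repeatedCuts t M N↭ M! t<M = record
    { cuts      = left e ∷ right e ∷ map sibling M
    ; levels    = ↭-trans
        (↭-reflexive (cong₂ _∷_ left-level (cong₂ _∷_ (sibling-level t∈N) (sibling-levels M⊆N))))
        (↭-sym N↭)
    ; below     = subst (_⊑ v) (sym parent-l) e⊑v
                ∷ sibling-below t∈N
                ∷ All.map⁺ (All.map sibling-below M⊆N)
    ; antichain = (left-right ∷ below-siblings (sym parent-l ◅ ε))
                ∷ below-siblings (sym (sibling-parent t∈N) ◅ ε)
                ∷ AllPairs-map siblings-incomparable M⊆N M!
    ; deleted   = λ w → mk⇔ ⇒ ⇐
    }
    where
    e : Vertex
    e = v[ suc t ]

    t∈N : t ∈ N
    t∈N = ↭.∈-resp-↭ (↭-sym N↭) (here refl)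

    M⊆N : All (_∈ N) M
    M⊆N = All.tabulate λ j∈M → ↭.∈-resp-↭ (↭-sym N↭) (there (there j∈M))

    h≡1+t : pathEnd N ≡ suc t
    h≡1+t = pathEnd-repeated N↭ t<M

    e-level : level e ≡ suc t
    e-level = path-level N v (s≤s z≤n) (<r t∈N)

    e⊑v : e ⊑ v
    e⊑v = path-⊑-v (s≤s z≤n) (<r t∈N)

    parent-l : parent (left e) ≡ e
    parent-l = parent-left (subst (1 <_) (sym e-level) (s≤s (1≤ t∈N)))

    left-level : level (left e) ≡ t
    left-level = level-left e (1≤ t∈N) e-level

    left-right : Incomparable (left e) (right e)
    left-right = (λ l⊑r → left≢right e e (⊑-antisym-level {left e} {right e} l⊑r ≤-refl)) ,
                 (λ r⊑l → left≢right e e (sym (⊑-antisym-level {right e} {left e} r⊑l ≤-refl)))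

    below-siblings : ∀ {x} → x ⊑ e → All (Incomparable x) (map sibling M)
    below-siblings x⊑e = All.map⁺ (All.zipWith
      (λ (j∈N , t<j) → sibling-incomparable j∈N (x⊑e ◅◅ path-⊑ N v (s≤s z≤n) t<j (<⇒≤ (<r j∈N))))
      (M⊆N , t<M))

    e-end : v[ pathEnd N ] ≡ e
    e-end = cong v[_] h≡1+t

    ⇒ : ∀ {w} → Deleted N v w → Any (w ⊑_) (left e ∷ right e ∷ map sibling M)
    -- Side deletions occur at levels above t, hence at parts in M.
    ⇒ (side j h≤j j<r eq w⊑) with subst (_≤ j) h≡1+t h≤j
    ... | t<j with ↭.∈-resp-↭ N↭ (turns-left⇒∈ N v (≤-trans (s≤s z≤n) t<j) j<r eq)
    ...   | here refl         = contradiction t<j 1+n≰n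
    ...   | there (here refl) = contradiction t<j 1+n≰n
    ...   | there (there j∈M) = there (there (Any.map⁺ (lose j∈M w⊑)))
    ⇒ {w} (end _ (inj₁ w⊑)) = here (subst (λ x → w ⊑ left x) e-end w⊑)
    ⇒ {w} (end _ (inj₂ w⊑)) = there (here (subst (λ x → w ⊑ right x) e-end w⊑))

    h≢1 : pathEnd N ≢ 1
    h≢1 h≡1 = m<n⇒n≢0 (1≤ t∈N) (suc-injective (trans (sym h≡1+t) h≡1))

    ⇐ : ∀ {w} → Any (w ⊑_) (left e ∷ right e ∷ map sibling M) → Deleted N v w
    ⇐ {w} (here w⊑)         = end h≢1 (inj₁ (subst (λ x → w ⊑ left x) (sym e-end) w⊑))
    ⇐ {w} (there (here w⊑)) = end h≢1 (inj₂ (subst (λ x → w ⊑ right x) (sym e-end) w⊑))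
    ⇐ (there (there w∈)) with find (Any.map⁻ w∈)
    ... | j , j∈M , w⊑ = side-sibling (All.lookup M⊆N j∈M)
          (subst (_≤ j) (sym h≡1+t) (All.lookup t<M j∈M)) w⊑

  cTreeCuts : Shape N → CTreeCuts N v
  cTreeCuts (distinct N!)            = distinctCuts N!
  cTreeCuts (repeated t M N↭ M! t<M) = repeatedCuts t M N↭ M! t<M

-- Forests of signed partitions

maxPart-∈ : ∀ {P} → All (1 ≤_) P → 1 ≤ νSum P → maxPart P ∈ P
maxPart-∈ {x ∷ xs} (1≤x ∷ _) _ with argmax-sel id 0 (x ∷ xs)
... | inj₂ m∈P = m∈P
-- The default 0 cannot be the maximum, since it would bound the positive part x.
... | inj₁ m≡0 = contradiction (subst (x ≤_) m≡0 (All.head (xs≤max 0 (x ∷ xs)))) (<⇒≱ 1≤x)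

∈⇒↭∷ : ∀ {A : Set} {x : A} {xs} → x ∈ xs → ∃ λ ys → xs ↭ x ∷ ys
∈⇒↭∷ {x = x} x∈xs with ∈-∃++ x∈xs
... | ys , zs , refl = ys ++ zs , ↭.shift x ys zs

maxPart-greedy : ∀ {P k ks} → GreedyList (k ∷ ks) → P ↭ k ∷ ks → maxPart P ≡ k
maxPart-greedy g P↭ = max≈v⁺ (↭.∈-resp-↭ (↭-sym P↭) (here refl))
  (↭.All-resp-↭ (↭-sym P↭) (≤-refl ∷ descending g)) z≤n

-- What the construction uses of (P , N). `N<P` keeps every part of N below the root of the C-tree,
-- so that the path can turn at its level.
record Realisable (P N : List ℕ) : Set where
  field
    1≤P   : All (1 ≤_) P
    1≤N   : All (1 ≤_) N
    N<P   : All (_< maxPart P) N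
    shape : Shape N

forest-good : ∀ {n P N S} → n + νSum N ≡ νSum P → Realisable P N → IsSABPForest P N S →
              IsGoodForest n (parts P N) S
forest-good {n} {P} {N} {S} sum≡ real
  (Q , C , F , P↭ , (v , v≡max , C≐) , (roots , Q↭ , separated , F≐) , C⋮F , S≐)
  = (elements , proj₁ elements-enumerate , size≡n , proj₂ elements-enumerate) ,
    subst (Card (Cut S)) parts≡ card-cut , allButOneComplete
  where
  open Realisable real
  open CTreeCuts (cTreeCuts {N} {v} 1≤N (subst (λ r → All (_< r) N) (sym v≡max) N<P) shape)

  C≐trimmed : C ≐ Trimmed v cuts
  C≐trimmed =
    (λ Cw → proj₁ (proj₁ C≐ Cw) , proj₂ (proj₁ C≐ Cw) ∘ from (deleted _)) ,
    (λ (w⊑v , w∉) → proj₂ C≐ (w⊑v , w∉ ∘ to (deleted _)))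

  open TrimmedForest C≐trimmed F≐ S≐ below antichain separated C⋮F

  P↭levels : P ↭ map level (v ∷ roots)
  P↭levels = ↭-trans P↭ (↭-trans (prep _ Q↭) (↭-reflexive (cong (_∷ map level roots) (sym v≡max))))

  size≡n : length elements ≡ n
  size≡n = +-cancelʳ-≡ (νSum N) _ _ (begin
    length elements + νSum N         ≡⟨ cong (length elements +_) (νSum-↭ levels) ⟨
    length elements + levelSum cuts  ≡⟨ size ⟩
    levelSum (v ∷ roots)             ≡⟨ νSum-↭ P↭levels ⟨
    νSum P                           ≡⟨ sum≡ ⟨
    n + νSum N                       ∎)
    where open ≡-Reasoning

  parts≡ : length (v ∷ roots) + length cuts ≡ parts P N
  parts≡ = cong₂ _+_
    (trans (sym (length-map level (v ∷ roots))) (sym (↭.↭-length P↭levels)))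
    (trans (sym (length-map level cuts)) (↭.↭-length levels))

-- Placement of the trees in disjoint blocks

module Placement (H : ℕ) where

  -- Blocks are the subtrees of the vertices of level H + 1; H will be the largest part, so every
  -- root fits.
  InBlock : ℕ → Vertex → Set
  InBlock i u = u ⊑ (H , i)

  block-unique : ∀ {i j u} → InBlock i u → InBlock j u → i ≡ j
  block-unique u∈i u∈j = cong proj₂ (⊑-ancestor-unique u∈i u∈j refl)

  -- An edge between two blocks would put its lower end in both, since a block contains the children
  -- of its vertices.
  blocks-separated : ∀ {i j u v} → i ≢ j → InBlock i u → InBlock j v →
                     Separated (Subtree u) (Subtree v)
  blocks-separated i≢j u∈i v∈j x⊑u y⊑v =
    (λ { refl → i≢j (block-unique (x⊑u ◅◅ u∈i) (y⊑v ◅◅ v∈j)) }) ,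
    λ { (inj₁ refl) → i≢j (block-unique (⊑-parent _ ◅◅ x⊑u ◅◅ u∈i) (y⊑v ◅◅ v∈j))
                     ; (inj₂ refl) → i≢j (block-unique (x⊑u ◅◅ u∈i) (⊑-parent _ ◅◅ y⊑v ◅◅ v∈j)) }

  -- Descends leftwards from the top of the block.
  vertexIn : ∀ i {l} → 1 ≤ l → l ≤ suc H → ∃ λ u → level u ≡ l × InBlock i u
  vertexIn i {suc k} _ (s≤s k≤H) = go (H ∸ k) (m∸n+n≡m k≤H)
    where
    go : ∀ d {k} → d + k ≡ H → ∃ λ u → level u ≡ suc k × InBlock i u
    go zero    refl = (H , i) , refl , ε
    go (suc d) {k} eq with go d {suc k} (trans (+-suc d k) eq)
    ... | u , u-level , u∈i = left u , level-left u (s≤s z≤n) u-level ,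
          sym (parent-left (subst (1 <_) (sym u-level) (s≤s (s≤s z≤n)))) ◅ u∈i

  place : ∀ Q i → All (1 ≤_) Q → All (_≤ suc H) Q → ∃ λ roots →
          Q ≡ map level roots × All (λ u → ∃ λ j → i ≤ j × InBlock j u) roots ×
          SeparatedSubtrees roots
  place []      i _           _           = [] , refl , [] , []
  place (q ∷ Q) i (1≤q ∷ 1≤Q) (q≤H ∷ Q≤H)
    with vertexIn i 1≤q q≤H | place Q (suc i) 1≤Q Q≤H
  ... | u , refl , u∈i | roots , refl , later , separated =
        u ∷ roots , refl ,
        (i , ≤-refl , u∈i) ∷ All.map (λ (j , i<j , v∈j) → j , <⇒≤ i<j , v∈j) later ,
        All.map {Q = λ v → Separated (Subtree u) (Subtree v)}
          (λ (j , i<j , v∈j) → blocks-separated (<⇒≢ i<j) u∈i v∈j) later ∷ separated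

forest-exists : ∀ {P N} → Realisable P N → 1 ≤ νSum P → ∃ λ S → IsSABPForest P N S
forest-exists {P} {N} real 1≤νP
  with Q , P↭ ← ∈⇒↭∷ (maxPart-∈ (Realisable.1≤P real) 1≤νP)
  with 1≤r ∷ 1≤Q ← ↭.All-resp-↭ P↭ (Realisable.1≤P real)
     | _ ∷ Q≤r ← ↭.All-resp-↭ P↭ (xs≤max 0 P)
  -- The C-tree occupies block 0, the complete trees the blocks from 1 on.
  with v , v≡r , v∈0 ← Placement.vertexIn (maxPart P) 0 1≤r (n≤1+n _)
  with roots , Q≡ , later , separated ← Placement.place (maxPart P) Q 1 1≤Q (All.map m≤n⇒m≤1+n Q≤r)
  = _ , Q , (λ w → w ⊑ v × ¬ Deleted N v w) , Subtrees roots , P↭ , (v , v≡r , id , id) ,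
    (roots , ↭-reflexive Q≡ , separated , id , id) ,
    (λ (x⊑v , _) y∈ → let (_ , 1≤j , ρ∈j) , y⊑ρ = All.lookupAny later y∈ in
       Placement.blocks-separated (maxPart P) (<⇒≢ 1≤j) v∈0 ρ∈j x⊑v y⊑ρ) ,
    id , id

-- The larger sum has a head at least that of the smaller, so if the heads differ, every part of N
-- is below the largest part of P. Disjointness ensures this for a normal form, minimal cost for an
-- optimal pair.
heads-differ⇒realisable : ∀ {n P N ks ls} → 1 ≤ n → P ↭ ks → N ↭ ls →
  GreedyList ks → GreedyList ls → νSum ks ≡ n + νSum ls →
  (∀ {k ks′ ls′} → ks ≡ k ∷ ks′ → ls ≢ k ∷ ls′) → Realisable P N
heads-differ⇒realisable {n} {P} {N} {ks} {ls} 1≤n P↭ N↭ g h sum≡ differ = record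
  { 1≤P   = ↭.All-resp-↭ (↭-sym P↭) (greedyList-1≤ g)
  ; 1≤N   = ↭.All-resp-↭ (↭-sym N↭) (greedyList-1≤ h)
  ; N<P   = ↭.All-resp-↭ (↭-sym N↭) (ls<P ks ls P↭ g h sum≡ differ)
  ; shape = Shape-resp-↭ N↭ (greedyShape h)
  }
  where
  ls<P : ∀ ks ls → P ↭ ks → GreedyList ks → GreedyList ls → νSum ks ≡ n + νSum ls →
         (∀ {k ks′ ls′} → ks ≡ k ∷ ks′ → ls ≢ k ∷ ls′) → All (_< maxPart P) ls
  ls<P _        []       _  _ _ _    _ = []
  ls<P []       (l ∷ ls) _  _ _ sum≡ _ =
    contradiction (sym sum≡) (m<n⇒n≢0 (≤-trans 1≤n (m≤m+n n _)))
  ls<P (k ∷ ks) (l ∷ ls) P↭ g h sum≡ differ =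
    subst (λ r → All (_< r) (l ∷ ls)) (sym (maxPart-greedy g P↭))
          (l<k ∷ All.map (λ i≤l → ≤-<-trans i≤l l<k) (descending h))
    where
    open ≤-Reasoning
    l≤k : l ≤ k
    l≤k = ≮⇒≥ λ k<l → <⇒≱ (ν-double-< k<l) (begin
      ν l                    ≤⟨ m≤m+n (ν l) (νSum ls) ⟩
      νSum (l ∷ ls)          ≤⟨ m≤n+m _ n ⟩
      n + νSum (l ∷ ls)      ≡⟨ sum≡ ⟨
      νSum (k ∷ ks)          ≤⟨ head-ub g ⟩
      ν k + ν k              ∎)

    l<k : l < k
    l<k = ≤∧≢⇒< l≤k λ { refl → differ refl refl }

normalForm⇒realisable : ∀ {n P N} → 1 ≤ n → IsSABP n P N → IsNormalForm n P N → Realisable P N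
normalForm⇒realisable {n} 1≤n (_ , _ , sum≡)
                      (disjoint , (ks , run-ks , P↭) , (ls , run-ls , N↭) , _) =
  heads-differ⇒realisable 1≤n P↭ N↭ (run⇒greedyList run-ks) (run⇒greedyList run-ls)
    (trans (run-sum run-ks) (trans (sym sum≡) (cong (n +_) (sym (run-sum run-ls)))))
    λ { refl refl → disjoint (↭.∈-resp-↭ (↭-sym P↭) (here refl) ,
                              ↭.∈-resp-↭ (↭-sym N↭) (here refl)) }

-- Minimal signed partitions

cost≤parts : ∀ {n P N} → IsSABP n P N → cost n (νSum N) ≤ parts P N
cost≤parts {n} {P} {N} (_ , _ , sum≡) =
  cost-≤ (subst (λ m → GreedyWithin m (length P)) (sym sum≡) (greedy-optimal P)) (greedy-optimal N)

greedy-SABP : ∀ n m → IsSABP n (greedy (n + m)) (greedy m)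
greedy-SABP n m = greedyList-1≤ (greedy-isGreedy (n + m)) , greedyList-1≤ (greedy-isGreedy m) ,
  trans (cong (n +_) (greedy-sum m)) (sym (greedy-sum (n + m)))

-- Were the heads equal, cancelling them would save two parts.
optimum-realisable : ∀ {n m} → 1 ≤ n → (∀ m′ → cost n m ≤ cost n m′) →
                     Realisable (greedy (n + m)) (greedy m)
optimum-realisable {n} {m} 1≤n optimal =
  heads-differ⇒realisable 1≤n ↭-refl ↭-refl
    (greedy-isGreedy (n + m)) (greedy-isGreedy m) (sym sum≡) differ
  where
  sum≡ : n + νSum (greedy m) ≡ νSum (greedy (n + m))
  sum≡ = proj₂ (proj₂ (greedy-SABP n m))

  differ : ∀ {k ks ls} → greedy (n + m) ≡ k ∷ ks → greedy m ≢ k ∷ ls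
  differ {k} {ks} {ls} ks≡ ls≡ = <⇒≱ cheaper (optimal (νSum ls))
    where
    tails≡ : νSum (k ∷ ks) ≡ n + νSum (k ∷ ls)
    tails≡ = trans (cong νSum (sym ks≡)) (trans (sym sum≡) (cong (λ l → n + νSum l) ls≡))

    open ≤-Reasoning
    cheaper : cost n (νSum ls) < cost n m
    cheaper = begin-strict
      cost n (νSum ls)                   ≤⟨ cost-cancel n
                                              (subst GreedyList ks≡ (greedy-isGreedy (n + m)))
                                              (subst GreedyList ls≡ (greedy-isGreedy m)) tails≡ ⟩
      length ks + length ls              <⟨ +-mono-< (n<1+n _) (n<1+n _) ⟩
      length (k ∷ ks) + length (k ∷ ls)  ≡⟨ cong₂ _+_ (cong length ks≡) (cong length ls≡) ⟨
      cost n m                           ∎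

realisable⇒good : ∀ {n P N} → 1 ≤ n → IsSABP n P N → Realisable P N →
  (∃ λ S → IsSABPForest P N S) × (∀ S → IsSABPForest P N S → IsGoodForest n (parts P N) S)
realisable⇒good {n} 1≤n (_ , _ , sum≡) real =
  forest-exists real (subst (1 ≤_) sum≡ (≤-trans 1≤n (m≤m+n n _))) ,
  λ S → forest-good sum≡ real

theorem3p13 : ∀ (n : ℕ) → 1 ≤ n →
    ∃ λ (t : ℕ) →
    IsTau n t ×
    IsDelta n t ×
    (∃ λ (S : Pred Vertex 0ℓ) → IsGoodForest n t S) ×
    (∀ (P N : List ℕ) → IsMinimalSABP n P N → IsNormalForm n P N →
    (∃ λ (S : Pred Vertex 0ℓ) → IsSABPForest P N S) ×
    (∀ (S : Pred Vertex 0ℓ) → IsSABPForest P N S → IsGoodForest n t S))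
-- The forest of the greedy pair at the optimal m gives both the upper bound on δ and the required
-- subforest.
theorem3p13 n 1≤n with m , optimal ← optimum 1≤n
  with (S , S-forest) , good ←
         realisable⇒good 1≤n (greedy-SABP n m) (optimum-realisable 1≤n optimal)
  with S-good@(S-card , S-cut , _) ← good S S-forest
  = cost n m , tau , (((S , S-card , S-cut) , cut-bound) , (S , S-good) , normal-forms)
  where
  tau : IsTau n (cost n m)
  tau = (_ , _ , greedy-SABP n m , refl) , λ { _ (P , N , sabp , refl) →
    ≤-trans (optimal (νSum N)) (cost≤parts sabp) }

  cut-bound : ∀ k → (∃ λ (S : Pred Vertex 0ℓ) → Card S n × Card (Cut S) k) → cost n m ≤ k
  cut-bound k (S , S-card , S-cut) = proj₂ tau k (cut⇒SABP S S-card S-cut)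

  normal-forms : ∀ P N → IsMinimalSABP n P N → IsNormalForm n P N →
    (∃ λ S → IsSABPForest P N S) × (∀ S → IsSABPForest P N S → IsGoodForest n (cost n m) S)
  normal-forms P N (sabp , minimal) nf =
    -- Both part counts are least possible, so `parts P N` equals `cost n m`.
    subst (λ t → (∃ λ S → IsSABPForest P N S) × (∀ S → IsSABPForest P N S → IsGoodForest n t S))
      (≤-antisym (proj₂ minimal _ (proj₁ tau)) (proj₂ tau _ (proj₁ minimal)))
      (realisable⇒good 1≤n sabp (normalForm⇒realisable 1≤n sabp nf))
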